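{- Let $n\ge3$ and let $\mathbb T$ be a triangulation of an $n$-gon with quiddity $(c_u)_{u\in\mathbb Z}$. For all integers $i,j$ with $0\le j-i\le n+1$, $$\nu^{\mathrm{tri}}_{i,j}=\begin{cases}\ell_{i,j}&\text{if } i\le j\le i+n-2,\\ \ell_{i,i+n-1}+1=n-2&\text{if } j=i+n-1,\\ \ell_{i,i+n}+c_i+1=n-2+c_i&\text{if } j=i+n,\\ \ell_{i,i+n+1}+c_i+c_{i+1}+1=n-2+c_i+c_{i+1}&\text{if } j=i+n+1,\end{cases}$$ where $\nu^{\mathrm{tri}}_{i,j}$ is the number of occurrences of $1$ in the triangular region for $(i,j)$ of the Conway--Coxeter frieze of $\mathbb T$, and $\ell_{i,j}$ is the accumulated descendant degree.
   Context: Triangulations. Let $n\ge3$ and let $\mathcal P$ be a convex $n$-gon with vertices numbered clockwise $v_0,\dots,v_{n-1}$; indices are extended to $\mathbb Z$ by $v_{u+n}=v_u$. A triangulation $\mathbb T$ of $\mathcal P$ is by $n-3$ non-crossing diagonals; its triangles are called cells. Let $c_u$ be the number of cells having $v_u$ as a vertex; the $n$-periodic sequence $(c_u)_{u\in\mathbb Z}$ is the quiddity of $\mathbb T$. Conway--Coxeter frieze of $\mathbb T$: the array of integers $\sigma_{k,\ell}$, $0\le\ell-k\le n+1$, determined by $\sigma_{k,k}=0$, $\sigma_{k,k+1}=1$, $\sigma_{k,k+2}=c_{k+1}$ and, recursively for $\ell-k\ge3$, $\sigma_{k,\ell-1}\sigma_{k+1,\ell}-\sigma_{k+1,\ell-1}\sigma_{k,\ell}=1$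 (well defined in this range). $\nu^{\mathrm{tri}}_{k,\ell}=\#\{(a,b): k\le a,\ a+2\le b\le\ell,\ \sigma_{a,b}=1\}$. Descendant degree with respect to the base edge $v_{i-1}v_i$: for $i\le j\le i+n-1$, $\mu_{i,j}$ is the number of diagonals of $\mathbb T$ joining $v_j$ to a vertex $v_\alpha$ with $i\le\alpha\le j-2$. (Equivalently, if the cells at $v_j$ are numbered counterclockwise around $v_j$ as $\mathcal C_0,\dots,\mathcal C_{c_j-1}$ starting from the one containing the edge $v_{j-1}v_j$, then $\mathcal C_{\mu_{i,j}}$ is the one separated from the base edge by the fewest diagonals.) Moreover $\mu_{i,i+n}=\mu_{i,i}=0$ and $\mu_{i,i+n+1}=\mu_{i,i+1}=0$. Accumulated descendant degrees: $\ell_{i,i-1}=0$ and $\ell_{i,j}=\ell_{i,j-1}+\mu_{i,j}$ for $i\le j\le i+n+1$; hence $\ell_{i,i+n-1}=\ell_{i,i+n}=\ell_{i,i+n+1}$. -}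

module Defs where

open import Data.Bool.Base using (if_then_else_)
open import Data.Fin.Base as Fin using (Fin; toℕ; fromℕ<)
import Data.Fin.Properties as Fin
open import Data.Integer.Base using (ℤ; +_; -[1+_]; 0ℤ; 1ℤ; _+_; _-_; _*_; _≤_; ∣_∣; _%ℕ_)
import Data.Integer.Properties as ℤ
open import Data.Integer.DivMod using (n%ℕd<d)
open import Data.Integer.Divisibility.Signed using (_∣?_; divides)
open import Data.List.Base using (List; length; filter; map; upTo; allFin; cartesianProduct)
open import Data.List.Membership.Propositional using (_∈_)
import Data.List.Membership.DecPropositional as DecMembership
open import Data.List.Relation.Unary.All using (All)
open import Data.List.Relation.Unary.Unique.Propositional using (Unique)
open import Data.Nat.Base as ℕ using (ℕ; zero; suc; NonZero)
import Data.Nat.DivMod as ℕ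
import Data.Nat.Properties as ℕ
open import Data.Product.Base using (_×_; _,_)
open import Data.Product.Properties using (≡-dec)
open import Data.Sum.Base using (_⊎_)
open import Level using (Level)
open import Relation.Binary.Definitions using (DecidableEquality)
open import Relation.Binary.PropositionalEquality.Core using (_≡_)
open import Relation.Nullary using (¬_; Dec; yes; no; does)
open import Relation.Nullary.Decidable using (_×-dec_; _⊎-dec_)
open import Relation.Unary using (Pred; Decidable)

private
  variable
    a p : Level

count : {A : Set a} {P : Pred A p} → Decidable P → List A → ℕ
count P? xs = length (filter P? xs)

-- The integers k, k + 1, …, ℓ in increasing order; empty when ℓ < k.
range : ℤ → ℤ → List ℤ
range k ℓ = map (λ t → k + + t) (upTo (size (ℓ + 1ℤ - k)))
  where
  size : ℤ → ℕ
  size (+ m)    = m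
  size -[1+ _ ] = 0

-- The exact quotient x / y, for y ≠ 0 dividing x.  In the frieze below every
-- division with ℓ - k ≤ n + 1 is of this kind, since the entries σ_{a,b} with
-- 1 ≤ b - a ≤ n - 1 are positive; outside that case the value is a placeholder.
infixl 7 _÷_
_÷_ : ℤ → ℤ → ℤ
x ÷ y with y ∣? x
... | yes (divides q _) = q
... | no _              = 0ℤ

------------------------------------------------------------------------
-- Polygons and triangulations

module _ {n : ℕ} .{{_ : NonZero n}} where

  -- v u is the vertex v_u, with v_{u+n} = v_u.
  v : ℤ → Fin n
  v u = fromℕ< (n%ℕd<d u n)

  Next : Fin n → Fin n → Set
  Next x y = toℕ y ≡ suc (toℕ x) ℕ.% n

  Side : Fin n → Fin n → Set
  Side x y = Next x y ⊎ Next y x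

  Side? : ∀ x y → Dec (Side x y)
  Side? x y = (toℕ y ℕ.≟ suc (toℕ x) ℕ.% n) ⊎-dec (toℕ x ℕ.≟ suc (toℕ y) ℕ.% n)

  -- A diagonal is recorded once, with its smaller endpoint first.
  IsDiagonal : Fin n × Fin n → Set
  IsDiagonal (x , y) = x Fin.< y × ¬ Side x y

  -- Two chords of a convex polygon meet in their interiors exactly when
  -- their endpoints strictly alternate around the boundary.
  Crossing : Fin n × Fin n → Fin n × Fin n → Set
  Crossing (x , y) (z , w) =
    (x Fin.< z × z Fin.< y × y Fin.< w) ⊎ (z Fin.< x × x Fin.< w × w Fin.< y)

record Triangulation (n : ℕ) .{{_ : NonZero n}} : Set where
  field
    diagonals   : List (Fin n × Fin n)
    isDiagonal  : All IsDiagonal diagonals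
    distinct    : Unique diagonals
    number      : length diagonals ≡ n ℕ.∸ 3
    nonCrossing : ∀ {d e} → d ∈ diagonals → e ∈ diagonals → ¬ Crossing d e

module _ {n : ℕ} .{{_ : NonZero n}} (𝕋 : Triangulation n) where

  open Triangulation 𝕋

  -- The segment with endpoints x and y, in either order, is a diagonal of 𝕋.
  Diagonal : Fin n → Fin n → Set
  Diagonal x y = (x , y) ∈ diagonals ⊎ (y , x) ∈ diagonals

  Diagonal? : ∀ x y → Dec (Diagonal x y)
  Diagonal? x y = ((x , y) ∈? diagonals) ⊎-dec ((y , x) ∈? diagonals)
    where
    _≟_ : DecidableEquality (Fin n × Fin n)
    _≟_ = ≡-dec Fin._≟_ Fin._≟_
    open DecMembership _≟_ using (_∈?_)

  Edge : Fin n → Fin n → Set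
  Edge x y = Side x y ⊎ Diagonal x y

  Edge? : ∀ x y → Dec (Edge x y)
  Edge? x y = Side? x y ⊎-dec Diagonal? x y

  -- A cell is a triangle bounded by sides of the polygon and diagonals of 𝕋
  -- (no further diagonal can enter such a triangle without crossing one of its
  -- sides); it is recorded once, by its vertices in increasing order.
  IsCell : Fin n × Fin n × Fin n → Set
  IsCell (x , y , z) = (x Fin.< y × y Fin.< z) × (Edge x y × Edge y z × Edge x z)

  IsCell? : Decidable IsCell
  IsCell? (x , y , z) =
    (x Fin.<? y ×-dec y Fin.<? z) ×-dec (Edge? x y ×-dec Edge? y z ×-dec Edge? x z)

  HasVertex : Fin n → Fin n × Fin n × Fin n → Set
  HasVertex w (x , y , z) = w ≡ x ⊎ w ≡ y ⊎ w ≡ z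

  HasVertex? : ∀ w → Decidable (HasVertex w)
  HasVertex? w (x , y , z) = (w Fin.≟ x) ⊎-dec (w Fin.≟ y) ⊎-dec (w Fin.≟ z)

  quiddity : ℤ → ℕ
  quiddity u = count (λ t → IsCell? t ×-dec HasVertex? (v u) t)
    (cartesianProduct (allFin n) (cartesianProduct (allFin n) (allFin n)))

------------------------------------------------------------------------
-- The Conway–Coxeter frieze

  -- entry d k is σ_{k,k+d}.  The last clause is the rule
  -- σ_{k,ℓ-1} σ_{k+1,ℓ} - σ_{k+1,ℓ-1} σ_{k,ℓ} = 1 solved for σ_{k,ℓ}.
  entry : ℕ → ℤ → ℤ
  entry 0                   k = 0ℤ
  entry 1                   k = 1ℤ
  entry 2                   k = + quiddity (k + 1ℤ)
  entry (suc (suc (suc d))) k =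
    (entry (suc (suc d)) k * entry (suc (suc d)) (k + 1ℤ) - 1ℤ) ÷ entry (suc d) (k + 1ℤ)

  -- Meaningful for 0 ≤ ℓ - k ≤ n + 1 only.
  σ : ℤ → ℤ → ℤ
  σ k ℓ = entry ∣ ℓ - k ∣ k

  νᵗʳⁱ : ℤ → ℤ → ℕ
  νᵗʳⁱ k ℓ = count (λ { (a , b) → (a + + 2 ℤ.≤? b) ×-dec (σ a b ℤ.≟ 1ℤ) })
    (cartesianProduct (range k ℓ) (range k ℓ))

------------------------------------------------------------------------
-- Descendant degrees with respect to the base edge v_{i-1} v_i

  -- For i ≤ j ≤ i + n - 1 the indices α between i and j - 2 name distinct
  -- vertices, so counting α counts diagonals.  Beyond that range μ is 0.
  μ : ℤ → ℤ → ℕ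
  μ i j = if does (j ℤ.≤? i + + n - 1ℤ)
    then count (λ α → Diagonal? (v α) (v j)) (range i (j - + 2))
    else 0

  -- accumulate i d is ℓ_{i,i-1+d}.
  accumulate : ℤ → ℕ → ℕ
  accumulate i zero    = 0
  accumulate i (suc d) = accumulate i d ℕ.+ μ i (i + + d)

  -- Meaningful for i - 1 ≤ j ≤ i + n + 1 only.
  ℓ : ℤ → ℤ → ℕ
  ℓ i j = accumulate i ∣ j + 1ℤ - i ∣

{-# OPTIONS --safe #-}
module Submission where

-- A window of n consecutive vertices carries n - 2 chords, counting the base edge,
-- which is the maximum; hence every chord p q with q - p ≥ 2 has an apex c between p
-- and q such that p c and c q are edges again.  Label the two ends of the base edge by
-- the vectors (1,0) and (0,1), and every apex by the sum of the labels of the chord below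
-- it.  The Plücker relation between 2 × 2 determinants of labels is the frieze rule, so
-- σ_{p,q} = det (label p) (label q).  This determinant is 1 on edges, and writing the
-- labels as nonnegative combinations of those of a separating chord shows that it is at
-- least 2 elsewhere.  So the ones of the frieze are the edges of the triangulation, and
-- each column of the triangular region is compared with the descendant degree.

open import Defs
open import Data.Integer.Base as ℤ using (ℤ; +_; 0ℤ; 1ℤ)
open import Data.Nat.Base as ℕ using (ℕ; suc; NonZero; z≤n; s≤s)
open import Data.Product.Base using (_×_; _,_)
open import Relation.Binary.PropositionalEquality.Core using (_≡_)

-- A `Triangulation` only records `n - 3` noncrossing diagonals, with no triangle given, and
-- vertices are ordered cyclically while frieze indices are ordered linearly. Both difficulties are
-- met in a window `i … i + N`, where `N = n - 1`. Its two ends are joined by the base edge, a side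
-- of the polygon but a chord of the interval. This double role is the source of the summand `1` in
-- the last three cases: the frieze has a one there, and no descendant degree counts it. A window
-- reaches the entries of width at most `n - 1`. Those of width `n` and `n + 1` are `0` and `-1`,
-- hence never ones; without them the columns of `i + n` and `i + n + 1` are the last columns of the
-- windows starting at `i + 1` and `i + 2`. A last column sees all edges at its vertex but one, and
-- a vertex has one more edge than cells, so these columns contribute `c i` and `c (i + 1)`.

module FriezeTheory where

  import Algebra.Properties.AbelianGroup as AbelianGroup
  open import Data.Bool.Base using (if_then_else_; true; false)
  open import Data.Empty using (⊥; ⊥-elim)
  open import Data.Fin.Base as Fin using (Fin; toℕ)
  import Data.Fin.Properties as Fin
  open import Data.Integer.Base using (_%ℕ_; _/ℕ_)
  open import Data.Integer.Divisibility.Signed using (_∣?_; divides)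
  open import Data.Integer.DivMod using (n%ℕd<d; a≡a%ℕn+[a/ℕn]*n)
  import Data.Integer.Properties as ℤ
  import Data.Integer.Tactic.RingSolver as ℤ
  open import Data.List.Base using (List; []; _∷_; _++_; length; map; applyUpTo; filter; upTo; allFin; cartesianProduct)
  open import Data.List.Membership.Propositional using (_∈_)
  open import Data.List.Membership.Propositional.Properties
  open import Data.List.Properties using (length-++-sucʳ)
  open import Data.List.Relation.Unary.All as All using ([]; _∷_)
  open import Data.List.Relation.Unary.AllPairs using ([]; _∷_)
  open import Data.List.Relation.Unary.Any using (here; there)
  open import Data.List.Relation.Unary.Unique.Propositional using (Unique)
  import Data.List.Relation.Unary.Unique.Propositional.Properties as Unique
  open import Data.Nat.Base
  import Data.Nat.Divisibility as ℕ using (>⇒∤; divides)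
  open import Data.Nat.DivMod using (m<n⇒m%n≡m; n%n≡0)
  open import Data.Nat.Properties
  import Data.Nat.Tactic.RingSolver as ℕ
  open import Data.Product.Base using (proj₁; proj₂; ∃; ∃-syntax; Σ-syntax)
  open import Data.Sum.Base as Sum using (_⊎_; inj₁; inj₂)
  open import Data.Unit.Base using (⊤)
  open import Function.Base using (_∘_)
  open import Function.Bundles using (mk⇔)
  open import Relation.Binary.Definitions using (tri<; tri≈; tri>)
  open import Relation.Binary.PropositionalEquality
  open import Relation.Nullary using (¬_; Dec; yes; no; does; contradiction)
  open import Relation.Nullary.Decidable using (_×-dec_; dec-true; dec-false; does-⇔)

  -- Indicators and finite sums

  private
    variable
      P Q R : Set

  𝟙 : Dec P → ℕ
  𝟙 P? = if does P? then 1 else 0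

  𝟙-true : (P? : Dec P) → P → 𝟙 P? ≡ 1
  𝟙-true P? p rewrite dec-true P? p = refl

  𝟙-false : (P? : Dec P) → ¬ P → 𝟙 P? ≡ 0
  𝟙-false P? ¬p rewrite dec-false P? ¬p = refl

  𝟙≤1 : (P? : Dec P) → 𝟙 P? ≤ 1
  𝟙≤1 (yes _) = s≤s z≤n
  𝟙≤1 (no _)  = z≤n

  𝟙-cong : (P? : Dec P) (Q? : Dec Q) → (P → Q) → (Q → P) → 𝟙 P? ≡ 𝟙 Q?
  𝟙-cong P? Q? f g rewrite does-⇔ (mk⇔ f g) P? Q? = refl

  𝟙-mono : (P? : Dec P) {m : ℕ} → (P → 1 ≤ m) → 𝟙 P? ≤ m
  𝟙-mono (yes p) f = f p
  𝟙-mono (no _)  f = z≤n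

  𝟙-pos : (P? : Dec P) → P → 1 ≤ 𝟙 P?
  𝟙-pos P? p = ≤-reflexive (sym (𝟙-true P? p))

  𝟙-disjoint : (P? : Dec P) (Q? : Dec Q) (R? : Dec R) →
    (P → Q ⊎ R) → (Q → P) → (R → P) → (Q → R → ⊥) → 𝟙 P? ≡ 𝟙 Q? + 𝟙 R?
  𝟙-disjoint P? (yes q) (yes r) _ _ _ h = ⊥-elim (h q r)
  𝟙-disjoint P? (yes q) (no _)  _ f _ _ = 𝟙-true P? (f q)
  𝟙-disjoint P? (no _)  (yes r) _ _ g _ = 𝟙-true P? (g r)
  𝟙-disjoint P? (no ¬q) (no ¬r) h _ _ _ = 𝟙-false P? λ p → case (h p)
    where
    case : _ ⊎ _ → ⊥
    case (inj₁ q) = ¬q q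
    case (inj₂ r) = ¬r r

  ∑ : ℕ → (ℕ → ℕ) → ℕ
  ∑ zero    f = 0
  ∑ (suc n) f = ∑ n f + f n

  infixl 5 ∑
  syntax ∑ n (λ i → e) = ∑[ i < n ] e

  ∑-cong : ∀ n {f g} → (∀ i → i < n → f i ≡ g i) → ∑ n f ≡ ∑ n g
  ∑-cong zero    h = refl
  ∑-cong (suc n) h = cong₂ _+_ (∑-cong n λ i i<n → h i (m<n⇒m<1+n i<n)) (h n ≤-refl)

  ∑-mono : ∀ n {f g} → (∀ i → i < n → f i ≤ g i) → ∑ n f ≤ ∑ n g
  ∑-mono zero    h = z≤n
  ∑-mono (suc n) h = +-mono-≤ (∑-mono n λ i i<n → h i (m<n⇒m<1+n i<n)) (h n ≤-refl)

  ∑-+ : ∀ n f g → ∑[ i < n ] (f i + g i) ≡ ∑ n f + ∑ n g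
  ∑-+ zero    f g = refl
  ∑-+ (suc n) f g rewrite ∑-+ n f g = interchange (∑ n f) (∑ n g) (f n) (g n)
    where
    interchange : ∀ a b c d → (a + b) + (c + d) ≡ (a + c) + (b + d)
    interchange = ℕ.solve-∀

  ∑-zero : ∀ n {f} → (∀ i → i < n → f i ≡ 0) → ∑ n f ≡ 0
  ∑-zero n h = trans (∑-cong n h) (zeros n)
    where
    zeros : ∀ n → ∑ n (λ _ → 0) ≡ 0
    zeros zero    = refl
    zeros (suc n) = trans (+-identityʳ _) (zeros n)

  ∑-*ˡ : ∀ n c f → ∑[ i < n ] (c * f i) ≡ c * ∑ n f
  ∑-*ˡ zero    c f = sym (*-zeroʳ c)
  ∑-*ˡ (suc n) c f rewrite ∑-*ˡ n c f = sym (*-distribˡ-+ c (∑ n f) (f n))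

  ∑-swap : ∀ m n (f : ℕ → ℕ → ℕ) → ∑[ i < m ] ∑[ j < n ] f i j ≡ ∑[ j < n ] ∑[ i < m ] f i j
  ∑-swap zero    n f = sym (∑-zero n λ _ _ → refl)
  ∑-swap (suc m) n f = begin
    (∑[ i < m ] ∑[ j < n ] f i j) + ∑ n (f m)   ≡⟨ cong (_+ ∑ n (f m)) (∑-swap m n f) ⟩
    (∑[ j < n ] ∑[ i < m ] f i j) + ∑ n (f m)   ≡⟨ ∑-+ n (λ j → ∑[ i < m ] f i j) (f m) ⟨
    (∑[ j < n ] ((∑[ i < m ] f i j) + f m j))   ∎
    where open ≡-Reasoning

  ∑-suc : ∀ n f → ∑ (suc n) f ≡ f 0 + ∑ n (f ∘ suc)
  ∑-suc zero    f = +-comm 0 (f 0)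
  ∑-suc (suc n) f rewrite ∑-suc n f = +-assoc (f 0) _ _

  ∑-extend : ∀ {m n} f → m ≤ n → (∀ i → m ≤ i → i < n → f i ≡ 0) → ∑ n f ≡ ∑ m f
  ∑-extend {m} {n} f m≤n h = subst (λ k → ∑ k f ≡ ∑ m f) (m∸n+n≡m m≤n)
    (go (n ∸ m) λ i m≤i i< → h i m≤i (subst (i <_) (m∸n+n≡m m≤n) i<))
    where
    go : ∀ k → (∀ i → m ≤ i → i < k + m → f i ≡ 0) → ∑ (k + m) f ≡ ∑ m f
    go zero    h = refl
    go (suc k) h rewrite h (k + m) (m≤n+m m k) ≤-refl =
      trans (+-identityʳ _) (go k λ i m≤i i< → h i m≤i (m<n⇒m<1+n i<))

  ∑-δ : ∀ {n a} (g : ℕ → ℕ) → a < n → ∑[ i < n ] (𝟙 (i ≟ a) * g i) ≡ g a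
  ∑-δ {suc n} {a} g (s≤s a≤n) with m≤n⇒m<n∨m≡n a≤n
  ... | inj₁ a<n rewrite 𝟙-false (n ≟ a) (<⇒≢ a<n ∘ sym) =
    trans (+-identityʳ _) (∑-δ g a<n)
  ... | inj₂ refl rewrite 𝟙-true (n ≟ n) refl =
    trans (cong (_+ (g n + 0)) (∑-zero n λ i i<n → cong (_* g i) (𝟙-false (i ≟ n) (<⇒≢ i<n))))
          (+-identityʳ (g n))

  ∑-δ₁ : ∀ {n a} → a < n → ∑[ i < n ] 𝟙 (i ≟ a) ≡ 1
  ∑-δ₁ {n} a<n = trans (∑-cong n λ i _ → sym (*-identityʳ _)) (∑-δ (λ _ → 1) a<n)

  -- Triangulated intervals

  module Chords
    (N : ℕ) (D : ℕ → ℕ → Set) (D? : ∀ x y → Dec (D x y))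
    (D-sym : ∀ {x y} → D x y → D y x) (D-irrefl : ∀ {x} → ¬ D x x)
    (side : ∀ {x} → x < N → D x (suc x))
    (noncrossing : ∀ {a b c d} → a < c → c < b → b < d → d ≤ N → D a b → D c d → ⊥)
    where

    -- The gap of two drops the sides between consecutive indices but keeps the pair `0 N`, which is
    -- a side of the polygon as well. This is why a full window has `n - 2` chords and not `n - 3`.
    Inside : ℕ → ℕ → ℕ → ℕ → Set
    Inside a b x y = a ≤ x × 2 + x ≤ y × y ≤ b × D x y

    Inside? : ∀ a b x y → Dec (Inside a b x y)
    Inside? a b x y = (a ≤? x) ×-dec (2 + x ≤? y) ×-dec (y ≤? b) ×-dec D? x y

    chords : ℕ → ℕ → ℕ
    chords a b = ∑[ x < suc N ] ∑[ y < suc N ] 𝟙 (Inside? a b x y)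

    -- A triangulation of the polygon on `a … b` seen from its base `a b`; a node is the triangle
    -- resting on the base. The base edge itself is not stored and is supplied separately where it
    -- matters.
    data Tree : ℕ → ℕ → Set where
      leaf : ∀ {a} → Tree a (suc a)
      node : ∀ {a c b} → a < c → c < b → D a c → D c b → Tree a c → Tree c b → Tree a b

    LastNeighbour : ℕ → ℕ → ℕ → Set
    LastNeighbour a b c = a < c × c < b × D a c × (∀ {y} → c < y → y < b → ¬ D a y)

    lastNeighbour : ∀ {a} b → suc a < b → b ≤ N → ∃ (LastNeighbour a b)
    lastNeighbour {a} (suc b) (s≤s a<b) b<N with D? a b
    ... | yes ab = b , a<b , ≤-refl , ab , λ b<y y≤b → contradiction y≤b (<⇒≱ (s≤s b<y))
    ... | no ¬ab with m≤n⇒m<n∨m≡n a<b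
    ...   | inj₂ refl = contradiction (side (<-trans ≤-refl b<N)) ¬ab
    ...   | inj₁ 1+a<b with lastNeighbour b 1+a<b (<⇒≤ b<N)
    ...     | c , a<c , c<b , ac , last = c , a<c , m<n⇒m<1+n c<b , ac , last′
      where
      last′ : ∀ {y} → c < y → y < suc b → ¬ D a y
      last′ c<y (s≤s y≤b) ay with m≤n⇒m<n∨m≡n y≤b
      ... | inj₁ y<b  = last c<y y<b ay
      ... | inj₂ refl = ¬ab ay

    -- A chord jumping over `c` starts at `a`, since otherwise it crosses `a c`, and then ends at
    -- `b`, since `c` is the last neighbour of `a` before `b`. At this stage `c` need not be joined
    -- to `b`.
    inside-split : ∀ {a b c x y} → LastNeighbour a b c → b ≤ N → Inside a b x y →
      ((x ≡ a) × (y ≡ b) × D a b) ⊎ Inside a c x y ⊎ Inside c b x y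
    inside-split {a} {b} {c} {x} {y} (a<c , c<b , ac , last) b≤N (a≤x , x<y , y≤b , xy)
      with y ≤? c | c ≤? x
    ... | yes y≤c | _       = inj₂ (inj₁ (a≤x , x<y , y≤c , xy))
    ... | no  _   | yes c≤x = inj₂ (inj₂ (c≤x , x<y , y≤b , xy))
    ... | no y≰c  | no c≰x with m≤n⇒m<n∨m≡n a≤x | m≤n⇒m<n∨m≡n y≤b
    ...   | inj₁ a<x  | _         = ⊥-elim (noncrossing a<x (≰⇒> c≰x) (≰⇒> y≰c) (≤-trans y≤b b≤N) ac xy)
    ...   | inj₂ refl | inj₁ y<b  = contradiction xy (last (≰⇒> y≰c) y<b)
    ...   | inj₂ refl | inj₂ refl = inj₁ (refl , refl , xy)

    chords-split : ∀ {a b c} → LastNeighbour a b c → b ≤ N →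
      chords a b ≤ 𝟙 (D? a b) + (chords a c + chords c b)
    chords-split {a} {b} {c} last b≤N = begin
      chords a b
        ≤⟨ (∑-mono (suc N) λ x _ → ∑-mono (suc N) λ y _ → pointwise x y) ⟩
      ∑[ x < suc N ] ∑[ y < suc N ] (root x y + (left x y + right x y))
        ≡⟨ split ⟩
      (∑[ x < suc N ] ∑[ y < suc N ] root x y) + (chords a c + chords c b)
        ≡⟨ cong (_+ (chords a c + chords c b)) root-sum ⟩
      𝟙 (D? a b) + (chords a c + chords c b) ∎
      where
      open ≤-Reasoning
      root left right : ℕ → ℕ → ℕ
      root x y = 𝟙 (x ≟ a) * (𝟙 (y ≟ b) * 𝟙 (D? a b))
      left x y = 𝟙 (Inside? a c x y)
      right x y = 𝟙 (Inside? c b x y)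
      pointwise : ∀ x y → 𝟙 (Inside? a b x y) ≤ root x y + (left x y + right x y)
      pointwise x y = 𝟙-mono (Inside? a b x y) λ ins → case (inside-split last b≤N ins)
        where
        case : ((x ≡ a) × (y ≡ b) × D a b) ⊎ Inside a c x y ⊎ Inside c b x y →
          1 ≤ root x y + (left x y + right x y)
        case (inj₁ (refl , refl , ab))
          rewrite 𝟙-true (a ≟ a) refl | 𝟙-true (b ≟ b) refl | 𝟙-true (D? a b) ab = s≤s z≤n
        case (inj₂ (inj₁ ins)) = ≤-trans (𝟙-pos (Inside? a c x y) ins)
          (≤-trans (m≤m+n _ (right x y)) (m≤n+m _ (root x y)))
        case (inj₂ (inj₂ ins)) = ≤-trans (𝟙-pos (Inside? c b x y) ins)
          (≤-trans (m≤n+m _ (left x y)) (m≤n+m _ (root x y)))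
      split : ∑[ x < suc N ] ∑[ y < suc N ] (root x y + (left x y + right x y))
        ≡ (∑[ x < suc N ] ∑[ y < suc N ] root x y) + (chords a c + chords c b)
      split = trans
        (∑-cong (suc N) λ x _ → trans (∑-+ (suc N) (root x) (λ y → left x y + right x y))
          (cong (λ s → ∑ (suc N) (root x) + s) (∑-+ (suc N) (left x) (right x))))
        (trans (∑-+ (suc N) (λ x → ∑ (suc N) (root x)) (λ x → ∑ (suc N) (left x) + ∑ (suc N) (right x)))
          (cong (λ s → ∑ (suc N) (λ x → ∑ (suc N) (root x)) + s) (∑-+ (suc N) (λ x → ∑ (suc N) (left x)) (λ x → ∑ (suc N) (right x)))))
      a<b : a < b
      a<b = <-trans (proj₁ last) (proj₁ (proj₂ last))
      root-sum : (∑[ x < suc N ] ∑[ y < suc N ] root x y) ≡ 𝟙 (D? a b)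
      root-sum = trans
        (∑-cong (suc N) λ x _ → trans (∑-*ˡ (suc N) (𝟙 (x ≟ a)) (λ y → 𝟙 (y ≟ b) * 𝟙 (D? a b)))
          (cong (𝟙 (x ≟ a) *_) (∑-δ (λ _ → 𝟙 (D? a b)) (s≤s b≤N))))
        (∑-δ (λ _ → 𝟙 (D? a b)) (s≤s (<⇒≤ (<-≤-trans a<b b≤N))))

    chords-leaf : ∀ a → chords a (suc a) ≡ 0
    chords-leaf a = ∑-zero (suc N) λ x _ → ∑-zero (suc N) λ y _ → 𝟙-false (Inside? a (suc a) x y)
      λ { (a≤x , x<y , y≤b , _) → <⇒≱ (≤-trans x<y y≤b) (s≤s a≤x) }

    -- An interval of b - a + 1 vertices holds at most b - a - 1 chords, and by
    -- induction along a last neighbour c it holds that many only if c is an apex.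
    chords-bound : ∀ k {a b} → a < b → b ≤ N → b ≤ k + a →
      chords a b + suc a ≤ b × (b ≤ chords a b + suc a → D a b × Tree a b)
    chords-bound zero a<b _ b≤a = contradiction b≤a (<⇒≱ a<b)
    chords-bound (suc k) {a} {b} a<b b≤N b≤k with m≤n⇒m<n∨m≡n a<b
    ... | inj₂ refl = ≤-reflexive (cong (_+ suc a) (chords-leaf a)) , λ _ → side b≤N , leaf
    ... | inj₁ 1+a<b with lastNeighbour b 1+a<b b≤N
    ...   | c , lastc@(a<c , c<b , ac , _) = bound , tight
      where
      open ≤-Reasoning
      left : chords a c + suc a ≤ c × (c ≤ chords a c + suc a → D a c × Tree a c)
      left = chords-bound k a<c (≤-trans (<⇒≤ c<b) b≤N) (s≤s⁻¹ (≤-trans c<b b≤k))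
      right : chords c b + suc c ≤ b × (b ≤ chords c b + suc c → D c b × Tree c b)
      right = chords-bound k c<b b≤N
        (≤-trans b≤k (≤-trans (≤-reflexive (sym (+-suc k a))) (+-monoʳ-≤ k a<c)))
      t p q : ℕ
      t = 𝟙 (D? a b)
      p = chords a c
      q = chords c b
      rearrange : ∀ t p q s → t + (p + q) + s ≡ t + (q + (p + s))
      rearrange = ℕ.solve-∀
      bound₀ : chords a b + suc a ≤ t + (q + (p + suc a))
      bound₀ = ≤-trans (+-monoˡ-≤ (suc a) (chords-split lastc b≤N)) (≤-reflexive (rearrange t p q (suc a)))
      bound₁ : chords a b + suc a ≤ t + (q + c)
      bound₁ = ≤-trans bound₀ (+-monoʳ-≤ t (+-monoʳ-≤ q (proj₁ left)))
      bound₂ : chords a b + suc a ≤ q + suc c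
      bound₂ = ≤-trans bound₁ (≤-trans (+-monoˡ-≤ (q + c) (𝟙≤1 (D? a b))) (≤-reflexive (sym (+-suc q c))))
      bound : chords a b + suc a ≤ b
      bound = ≤-trans bound₂ (proj₁ right)
      tight : b ≤ chords a b + suc a → D a b × Tree a b
      tight b≤ = ab , node a<c c<b ac (proj₁ right′) (proj₂ left′) (proj₂ right′)
        where
        right′ : D c b × Tree c b
        right′ = proj₂ right (≤-trans b≤ bound₂)
        left′ : D a c × Tree a c
        left′ = proj₂ left (+-cancelˡ-≤ (suc q) _ _ (begin
          suc q + c                 ≡⟨ +-suc q c ⟨
          q + suc c                 ≤⟨ proj₁ right ⟩
          b                         ≤⟨ ≤-trans b≤ bound₀ ⟩
          t + (q + (p + suc a))     ≤⟨ +-monoˡ-≤ (q + (p + suc a)) (𝟙≤1 (D? a b)) ⟩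
          suc q + (p + suc a)       ∎))
        ab : D a b
        ab with D? a b | ≤-trans (proj₁ right) (≤-trans b≤ bound₁)
        ... | yes ab | _  = ab
        ... | no _   | le = contradiction (≤-trans (≤-reflexive (sym (+-suc q c))) le) (<⇒≱ ≤-refl)

    -- Starting to the right of `a`, the edge would cross `a c`; ending to the left of `b`, it would
    -- cross `c b`.
    straddle : ∀ {a b c x y} → b ≤ N → D a c → D c b → a ≤ x → x < c → c < y → y ≤ b → D x y →
      (x ≡ a) × (y ≡ b)
    straddle b≤N ac cb a≤x x<c c<y y≤b xy with m≤n⇒m<n∨m≡n a≤x | m≤n⇒m<n∨m≡n y≤b
    ... | inj₁ a<x  | _         = ⊥-elim (noncrossing a<x x<c c<y (≤-trans y≤b b≤N) ac xy)
    ... | inj₂ refl | inj₁ y<b  = ⊥-elim (noncrossing x<c c<y y<b b≤N xy cb)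
    ... | inj₂ refl | inj₂ refl = refl , refl

    -- Every edge that is not a leaf is the base of a node: it stays inside one half on the way down
    -- until it passes over an apex, where `straddle` identifies it with the base.
    apex : ∀ {a b} → Tree a b → b ≤ N → ∀ {x y} → a ≤ x → y ≤ b → suc x < y → D x y →
      ∃[ c ] x < c × c < y × D x c × D c y
    apex leaf _ a≤x y≤b x<y _ = contradiction (≤-trans x<y y≤b) (≤⇒≯ (s≤s a≤x))
    apex (node {c = c} a<c c<b ac cb l r) b≤N {x} {y} a≤x y≤b x<y xy with y ≤? c | c ≤? x
    ... | yes y≤c | _       = apex l (≤-trans (<⇒≤ c<b) b≤N) a≤x y≤c x<y xy
    ... | no _    | yes c≤x = apex r b≤N c≤x y≤b x<y xy
    ... | no y≰c  | no c≰x with straddle b≤N ac cb a≤x (≰⇒> c≰x) (≰⇒> y≰c) y≤b xy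
    ...   | refl , refl = c , a<c , c<b , ac , cb

    apex-unique : ∀ {x y c d} → y ≤ N → x < c → c < y → x < d → d < y →
      D x c → D c y → D x d → D d y → c ≡ d
    apex-unique {c = c} {d} y≤N x<c c<y x<d d<y xc cy xd dy with <-cmp c d
    ... | tri< c<d _ _ = ⊥-elim (noncrossing x<c c<d d<y y≤N xd cy)
    ... | tri≈ _ c≡d _ = c≡d
    ... | tri> _ _ d<c = ⊥-elim (noncrossing x<d d<c c<y y≤N xc dy)

    -- Additive labellings of a triangulated interval.

    Additive : ∀ {a b} → (ℕ → ℤ) → Tree a b → Set
    Additive f leaf                               = ⊤
    Additive f (node {a} {c} {b} _ _ _ _ l r) = f c ≡ f a ℤ.+ f b × Additive f l × Additive f r

    additive-cong : ∀ {a b f g} (t : Tree a b) → (∀ x → a ≤ x → x ≤ b → f x ≡ g x) →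
      Additive f t → Additive g t
    additive-cong leaf _ _ = _
    additive-cong {a} {b} (node {c = c} a<c c<b _ _ l r) h (eq , fl , fr) =
      trans (sym (h c (<⇒≤ a<c) (<⇒≤ c<b)))
        (trans eq (cong₂ ℤ._+_ (h a ≤-refl (<⇒≤ (<-trans a<c c<b))) (h b (<⇒≤ (<-trans a<c c<b)) ≤-refl))) ,
      additive-cong l (λ x a≤x x≤c → h x a≤x (≤-trans x≤c (<⇒≤ c<b))) fl ,
      additive-cong r (λ x c≤x x≤b → h x (≤-trans (<⇒≤ a<c) c≤x) x≤b) fr

    -- The halves share only `c`, where both recursive labellings are prescribed to be `u + v`, so
    -- they can be glued. The end values `1 , 0` and `0 , 1` later give the two coordinates of the
    -- labels.
    additive-extension : ∀ {a b} (t : Tree a b) u v →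
      Σ[ f ∈ (ℕ → ℤ) ] f a ≡ u × f b ≡ v × Additive f t
    additive-extension {a} leaf u v =
      f , fa , fb , _
      where
      f : ℕ → ℤ
      f x = if does (x ≤? a) then u else v
      fa : f a ≡ u
      fa rewrite dec-true (a ≤? a) ≤-refl = refl
      fb : f (suc a) ≡ v
      fb rewrite dec-false (suc a ≤? a) (<⇒≱ ≤-refl) = refl
    additive-extension {a} {b} (node {c = c} a<c c<b _ _ l r) u v
      with additive-extension l u (u ℤ.+ v) | additive-extension r (u ℤ.+ v) v
    ... | f , fa , fc , fl | g , gc , gb , gr =
      h , ha , hb ,
      trans (hf ≤-refl) (trans fc (sym (cong₂ ℤ._+_ ha hb))) ,
      additive-cong l (λ x _ x≤c → sym (hf x≤c)) fl ,
      additive-cong r (λ x c≤x _ → sym (hg c≤x)) gr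
      where
      h : ℕ → ℤ
      h x = if does (x ≤? c) then f x else g x
      hf : ∀ {x} → x ≤ c → h x ≡ f x
      hf {x} x≤c rewrite dec-true (x ≤? c) x≤c = refl
      hg : ∀ {x} → c ≤ x → h x ≡ g x
      hg {x} c≤x with m≤n⇒m<n∨m≡n c≤x
      ... | inj₁ c<x rewrite dec-false (x ≤? c) (<⇒≱ c<x) = refl
      ... | inj₂ refl = trans (hf ≤-refl) (trans fc (sym gc))
      ha : h a ≡ u
      ha = trans (hf (<⇒≤ a<c)) fa
      hb : h b ≡ v
      hb = trans (hg (<⇒≤ c<b)) gb

    -- The coefficients are fixed before `f`, so both coordinates of a label share them, as
    -- expanding a determinant requires. Only at `b` can `p` vanish, and only at `a` can `q`.
    Combination : ∀ {a b} → Tree a b → ℕ → ℕ → ℕ → Set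
    Combination {a} {b} t x p q =
      (∀ {f} → Additive f t → f x ≡ + p ℤ.* f a ℤ.+ + q ℤ.* f b) × (x < b → 1 ≤ p) × (a < x → 1 ≤ q)

    combination : ∀ {a b} (t : Tree a b) {x} → a ≤ x → x ≤ b → ∃[ p ] ∃[ q ] Combination t x p q
    combination {a} leaf a≤x x≤b with m≤n⇒m<n∨m≡n a≤x
    ... | inj₂ refl = 1 , 0 , (λ {f} _ → first (f a) (f (suc a))) , (λ _ → ≤-refl) , λ a<a → contradiction a<a (n≮n a)
      where
      first : ∀ u v → u ≡ 1ℤ ℤ.* u ℤ.+ 0ℤ ℤ.* v
      first = ℤ.solve-∀
    ... | inj₁ a<x with ≤-antisym x≤b a<x
    ...   | refl = 0 , 1 , (λ {f} _ → second (f a) (f (suc a))) , (λ b<b → contradiction b<b (n≮n (suc a))) , λ _ → ≤-refl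
      where
      second : ∀ u v → v ≡ 0ℤ ℤ.* u ℤ.+ 1ℤ ℤ.* v
      second = ℤ.solve-∀
    combination {a} {b} (node {c = c} a<c c<b _ _ l r) {x} a≤x x≤b with ≤-total x c
    ... | inj₁ x≤c with combination l a≤x x≤c
    ...   | p , q , eq , p≥1 , q≥1 = p + q , q , formula , pos , q≥1
      where
      distrib : ∀ p q u v → p ℤ.* u ℤ.+ q ℤ.* (u ℤ.+ v) ≡ (p ℤ.+ q) ℤ.* u ℤ.+ q ℤ.* v
      distrib = ℤ.solve-∀
      formula : ∀ {f : ℕ → ℤ} → f c ≡ f a ℤ.+ f b × Additive f l × Additive f r → f x ≡ + (p + q) ℤ.* f a ℤ.+ + q ℤ.* f b
      formula {f} (fc , fl , _) = trans (eq fl)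
        (trans (cong (λ w → + p ℤ.* f a ℤ.+ + q ℤ.* w) fc) (distrib (+ p) (+ q) (f a) (f b)))
      pos : x < b → 1 ≤ p + q
      pos _ with m≤n⇒m<n∨m≡n x≤c
      ... | inj₁ x<c  = ≤-trans (p≥1 x<c) (m≤m+n p q)
      -- At the apex the left half allows `p = 0`; positivity of the sum then comes from `q`.
      ... | inj₂ refl = ≤-trans (q≥1 a<c) (m≤n+m q p)
    combination {a} {b} (node {c = c} a<c c<b _ _ l r) {x} a≤x x≤b
        | inj₂ c≤x with combination r c≤x x≤b
    ...   | p , q , eq , p≥1 , q≥1 = p , p + q , formula , p≥1 , pos
      where
      distrib : ∀ p q u v → p ℤ.* (u ℤ.+ v) ℤ.+ q ℤ.* v ≡ p ℤ.* u ℤ.+ (p ℤ.+ q) ℤ.* v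
      distrib = ℤ.solve-∀
      formula : ∀ {f : ℕ → ℤ} → f c ≡ f a ℤ.+ f b × Additive f l × Additive f r → f x ≡ + p ℤ.* f a ℤ.+ + (p + q) ℤ.* f b
      formula {f} (fc , _ , fr) = trans (eq fr)
        (trans (cong (λ w → + p ℤ.* w ℤ.+ + q ℤ.* f b) fc) (distrib (+ p) (+ q) (f a) (f b)))
      pos : a < x → 1 ≤ p + q
      pos _ with m≤n⇒m<n∨m≡n c≤x
      ... | inj₁ c<x  = ≤-trans (q≥1 c<x) (m≤n+m q p)
      ... | inj₂ refl = ≤-trans (p≥1 c<b) (m≤m+n p q)

    -- Neighbours of the end points inside an interval.

    inDegree outDegree : ℕ → ℕ → ℕ
    inDegree a b  = ∑[ x < suc N ] 𝟙 ((a <? x) ×-dec (x <? b) ×-dec D? x b)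
    outDegree a b = ∑[ x < suc N ] 𝟙 ((a <? x) ×-dec (x <? b) ×-dec D? x a)

    inDegree-leaf : ∀ a → inDegree a (suc a) ≡ 0
    inDegree-leaf a = ∑-zero (suc N) λ x _ → 𝟙-false ((a <? x) ×-dec (x <? suc a) ×-dec D? x (suc a))
      λ (a<x , x<b , _) → <⇒≱ x<b a<x

    outDegree-leaf : ∀ a → outDegree a (suc a) ≡ 0
    outDegree-leaf a = ∑-zero (suc N) λ x _ → 𝟙-false ((a <? x) ×-dec (x <? suc a) ×-dec D? x a)
      λ (a<x , x<b , _) → <⇒≱ x<b a<x

    -- The edge `a c` shuts `b` off from everything strictly between `a` and `c`, so the apex is the
    -- leftmost interior neighbour of `b`.
    inDegree-node : ∀ {a c b} → a < c → c < b → b ≤ N → D a c → D c b → inDegree a b ≡ 1 + inDegree c b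
    inDegree-node {a} {c} {b} a<c c<b b≤N ac cb = begin
      inDegree a b
        ≡⟨ (∑-cong (suc N) λ x _ → 𝟙-disjoint ((a <? x) ×-dec (x <? b) ×-dec D? x b) (x ≟ c)
             ((c <? x) ×-dec (x <? b) ×-dec D? x b) (to x)
             (λ { refl → a<c , c<b , cb }) (λ (c<x , rest) → <-trans a<c c<x , rest)
             (λ { refl (c<c , _) → n≮n c c<c })) ⟩
      ∑[ x < suc N ] (𝟙 (x ≟ c) + 𝟙 ((c <? x) ×-dec (x <? b) ×-dec D? x b))
        ≡⟨ ∑-+ (suc N) (λ x → 𝟙 (x ≟ c)) (λ x → 𝟙 ((c <? x) ×-dec (x <? b) ×-dec D? x b)) ⟩
      (∑[ x < suc N ] 𝟙 (x ≟ c)) + inDegree c b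
        ≡⟨ cong (_+ inDegree c b) (∑-δ₁ (s≤s (≤-trans (<⇒≤ c<b) b≤N))) ⟩
      1 + inDegree c b ∎
      where
      open ≡-Reasoning
      to : ∀ x → a < x × x < b × D x b → x ≡ c ⊎ (c < x × x < b × D x b)
      to x (a<x , x<b , xb) with <-cmp x c
      ... | tri< x<c _ _ = ⊥-elim (noncrossing a<x x<c c<b b≤N ac xb)
      ... | tri≈ _ x≡c _ = inj₁ x≡c
      ... | tri> _ _ c<x = inj₂ (c<x , x<b , xb)

    outDegree-node : ∀ {a c b} → a < c → c < b → b ≤ N → D a c → D c b → outDegree a b ≡ 1 + outDegree a c
    outDegree-node {a} {c} {b} a<c c<b b≤N ac cb = begin
      outDegree a b
        ≡⟨ (∑-cong (suc N) λ x _ → 𝟙-disjoint ((a <? x) ×-dec (x <? b) ×-dec D? x a) (x ≟ c)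
             ((a <? x) ×-dec (x <? c) ×-dec D? x a) (to x)
             (λ { refl → a<c , c<b , D-sym ac }) (λ (a<x , x<c , xa) → a<x , <-trans x<c c<b , xa)
             (λ { refl (_ , c<c , _) → n≮n c c<c })) ⟩
      ∑[ x < suc N ] (𝟙 (x ≟ c) + 𝟙 ((a <? x) ×-dec (x <? c) ×-dec D? x a))
        ≡⟨ ∑-+ (suc N) (λ x → 𝟙 (x ≟ c)) (λ x → 𝟙 ((a <? x) ×-dec (x <? c) ×-dec D? x a)) ⟩
      (∑[ x < suc N ] 𝟙 (x ≟ c)) + outDegree a c
        ≡⟨ cong (_+ outDegree a c) (∑-δ₁ (s≤s (≤-trans (<⇒≤ c<b) b≤N))) ⟩
      1 + outDegree a c ∎
      where
      open ≡-Reasoning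
      to : ∀ x → a < x × x < b × D x a → x ≡ c ⊎ (a < x × x < c × D x a)
      to x (a<x , x<b , xa) with <-cmp x c
      ... | tri< x<c _ _ = inj₂ (a<x , x<c , xa)
      ... | tri≈ _ x≡c _ = inj₁ x≡c
      ... | tri> _ _ c<x = ⊥-elim (noncrossing a<c c<x x<b b≤N (D-sym xa) cb)

    -- Down the right spine each apex adds `f (suc b)` to the label of the current left end. The
    -- apexes met are the interior neighbours of `suc b`, and the spine stops at the leaf that
    -- starts at `b`.
    before-last : ∀ {a b f} (t : Tree a (suc b)) → suc b ≤ N → Additive f t →
      f b ≡ f a ℤ.+ + inDegree a (suc b) ℤ.* f (suc b)
    before-last {a} {f = f} leaf _ _ rewrite inDegree-leaf a = sym (ℤ.+-identityʳ (f a))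
    before-last {a} {b} {f} (node {c = c} a<c c<b ac cb l r) b≤N (fc , _ , fr)
      rewrite inDegree-node a<c c<b b≤N ac cb =
      trans (before-last r b≤N fr) (trans (cong (ℤ._+ + inDegree c (suc b) ℤ.* f (suc b)) fc)
        (collect (f a) (f (suc b)) (+ inDegree c (suc b))))
      where
      collect : ∀ u v m → u ℤ.+ v ℤ.+ m ℤ.* v ≡ u ℤ.+ (1ℤ ℤ.+ m) ℤ.* v
      collect = ℤ.solve-∀

    -- The mirror image along the left spine, whose apexes are the interior neighbours of `a`.
    after-first : ∀ {a b f} (t : Tree a b) → b ≤ N → Additive f t →
      f (suc a) ≡ f b ℤ.+ + outDegree a b ℤ.* f a
    after-first {a} {f = f} leaf _ _ rewrite outDegree-leaf a = sym (ℤ.+-identityʳ (f (suc a)))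
    after-first {a} {b} {f} (node {c = c} a<c c<b ac cb l r) b≤N (fc , fl , _)
      rewrite outDegree-node a<c c<b b≤N ac cb =
      trans (after-first l (≤-trans (<⇒≤ c<b) b≤N) fl) (trans (cong (ℤ._+ + outDegree a c ℤ.* f a) fc)
        (collect (f a) (f b) (+ outDegree a c)))
      where
      collect : ∀ u v m → u ℤ.+ v ℤ.+ m ℤ.* u ≡ v ℤ.+ (1ℤ ℤ.+ m) ℤ.* u
      collect = ℤ.solve-∀

    -- Determinants of labels.

    module Determinant (X Y : ℕ → ℤ) where

      det : ℕ → ℕ → ℤ
      det x y = X x ℤ.* Y y ℤ.- X y ℤ.* Y x

      det-left : ∀ {a c b} → X c ≡ X a ℤ.+ X b → Y c ≡ Y a ℤ.+ Y b → det a c ≡ det a b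
      det-left {a} {c} {b} Xc Yc = trans (cong₂ (λ u v → X a ℤ.* v ℤ.- u ℤ.* Y a) Xc Yc)
        (identity (X a) (Y a) (X b) (Y b))
        where
        identity : ∀ x y u v → x ℤ.* (y ℤ.+ v) ℤ.- (x ℤ.+ u) ℤ.* y ≡ x ℤ.* v ℤ.- u ℤ.* y
        identity = ℤ.solve-∀

      det-right : ∀ {a c b} → X c ≡ X a ℤ.+ X b → Y c ≡ Y a ℤ.+ Y b → det c b ≡ det a b
      det-right {a} {c} {b} Xc Yc = trans (cong₂ (λ u v → u ℤ.* Y b ℤ.- X b ℤ.* v) Xc Yc)
        (identity (X a) (Y a) (X b) (Y b))
        where
        identity : ∀ x y u v → (x ℤ.+ u) ℤ.* v ℤ.- u ℤ.* (y ℤ.+ v) ≡ x ℤ.* v ℤ.- u ℤ.* y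
        identity = ℤ.solve-∀

      plücker : ∀ k l m n →
        det k m ℤ.* det l n ℤ.- det k l ℤ.* det m n ≡ det k n ℤ.* det l m
      plücker k l m n = identity (X k) (Y k) (X l) (Y l) (X m) (Y m) (X n) (Y n)
        where
        identity : ∀ a b c d e f g h →
          (a ℤ.* f ℤ.- e ℤ.* b) ℤ.* (c ℤ.* h ℤ.- g ℤ.* d) ℤ.- (a ℤ.* d ℤ.- c ℤ.* b) ℤ.* (e ℤ.* h ℤ.- g ℤ.* f)
          ≡ (a ℤ.* h ℤ.- g ℤ.* b) ℤ.* (c ℤ.* f ℤ.- e ℤ.* d)
        identity = ℤ.solve-∀

      det-refl : ∀ x → det x x ≡ 0ℤ
      det-refl x = ℤ.+-inverseʳ (X x ℤ.* Y x)

      -- The value 1 passes from a base to both halves, because adding one label to the other leaves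
      -- the determinant unchanged; an edge over the apex is the base itself.
      det-edge : ∀ {a b} (t : Tree a b) → b ≤ N → Additive X t → Additive Y t → det a b ≡ 1ℤ →
        ∀ {x y} → a ≤ x → x < y → y ≤ b → D x y → det x y ≡ 1ℤ
      det-edge leaf b≤N _ _ ab a≤x x<y y≤b _
        with ≤-antisym a≤x (s≤s⁻¹ (≤-trans x<y y≤b))
      ... | refl with ≤-antisym x<y y≤b
      ...   | refl = ab
      det-edge (node {a} {c} {b} a<c c<b ac cb l r) b≤N (Xc , Xl , Xr) (Yc , Yl , Yr) ab {x} {y} a≤x x<y y≤b xy
        with y ≤? c | c ≤? x
      ... | yes y≤c | _       = det-edge l (≤-trans (<⇒≤ c<b) b≤N) Xl Yl (trans (det-left Xc Yc) ab) a≤x x<y y≤c xy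
      ... | no _    | yes c≤x = det-edge r b≤N Xr Yr (trans (det-right Xc Yc) ab) c≤x x<y y≤b xy
      ... | no y≰c  | no c≰x with straddle b≤N ac cb a≤x (≰⇒> c≰x) (≰⇒> y≰c) y≤b xy
      ...   | refl , refl = ab

      -- For `x` and `y` on different sides of `c`, write `x` as `p a + q c` and `y` as `r c + s b`.
      -- With all three sides of the triangle of determinant 1, the determinant is
      -- `p r + p s + q s`. Here `p s` is positive, `q s` vanishes only for `x = a` and `p r` only
      -- for `y = b`. The form `+ suc m` serves both the exact division and the recognition of ones.
      det-pos : ∀ {a b} (t : Tree a b) → D a b → Additive X t → Additive Y t → det a b ≡ 1ℤ →
        ∀ {x y} → a ≤ x → x < y → y ≤ b → ∃[ m ] det x y ≡ + suc m × (m ≡ 0 → D x y)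
      det-pos leaf D-ab _ _ ab a≤x x<y y≤b
        with ≤-antisym a≤x (s≤s⁻¹ (≤-trans x<y y≤b))
      ... | refl with ≤-antisym x<y y≤b
      ...   | refl = 0 , ab , λ _ → D-ab
      det-pos (node {a} {c} {b} a<c c<b ac cb l r) D-ab (Xc , Xl , Xr) (Yc , Yl , Yr) ab {x} {y} a≤x x<y y≤b
        with y ≤? c | c ≤? x
      ... | yes y≤c | _       = det-pos l ac Xl Yl (trans (det-left Xc Yc) ab) a≤x x<y y≤c
      ... | no _    | yes c≤x = det-pos r cb Xr Yr (trans (det-right Xc Yc) ab) c≤x x<y y≤b
      ... | no y≰c  | no c≰x with combination l a≤x (≰⇒≥ c≰x) | combination r (≰⇒≥ y≰c) y≤b
      ...   | p , q , eqx , p≥1 , q≥1 | r′ , s , eqy , r≥1 , s≥1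
        with p≥1 (≰⇒> c≰x) | s≥1 (≰⇒> y≰c)
      det-pos (node {a} {c} {b} a<c c<b ac cb l r) D-ab (Xc , Xl , Xr) (Yc , Yl , Yr) ab {x} {y} a≤x x<y y≤b
        | no y≰c  | no c≰x | suc p , q , eqx , _ , q≥1 | r′ , suc s , eqy , r≥1 , _ | _ | _
        -- This is the sum of the three products, with `suc p` and `suc s` as positive coefficients,
        -- less one.
        = r′ + p * r′ + (s + p * suc s) + q * suc s , value , unique
        where
        combine : ∀ {f} → f c ≡ f a ℤ.+ f b → Additive f l → Additive f r →
          f x ≡ + suc p ℤ.* f a ℤ.+ + q ℤ.* (f a ℤ.+ f b) ×
          f y ≡ + r′ ℤ.* (f a ℤ.+ f b) ℤ.+ + suc s ℤ.* f b
        combine {f} fc fl fr =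
          trans (eqx fl) (cong (λ w → + suc p ℤ.* f a ℤ.+ + q ℤ.* w) fc) ,
          trans (eqy fr) (cong (λ w → + r′ ℤ.* w ℤ.+ + suc s ℤ.* f b) fc)
        identity : ∀ x y u v p q r s →
          (p ℤ.* x ℤ.+ q ℤ.* (x ℤ.+ u)) ℤ.* (r ℤ.* (y ℤ.+ v) ℤ.+ s ℤ.* v)
            ℤ.- (r ℤ.* (x ℤ.+ u) ℤ.+ s ℤ.* u) ℤ.* (p ℤ.* y ℤ.+ q ℤ.* (y ℤ.+ v))
          ≡ (p ℤ.* r ℤ.+ p ℤ.* s ℤ.+ q ℤ.* s) ℤ.* (x ℤ.* v ℤ.- u ℤ.* y)
        identity = ℤ.solve-∀
        coefficient : + suc p ℤ.* + r′ ℤ.+ + suc p ℤ.* + suc s ℤ.+ + q ℤ.* + suc s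
          ≡ + suc (r′ + p * r′ + (s + p * suc s) + q * suc s)
        coefficient rewrite sym (ℤ.pos-* (suc p) r′) | sym (ℤ.pos-* (suc p) (suc s)) | sym (ℤ.pos-* q (suc s)) =
          cong +_ (shift (r′ + p * r′) (s + p * suc s) (q * suc s))
          where
          shift : ∀ i j k → i + suc j + k ≡ suc (i + j + k)
          shift = ℕ.solve-∀
        value : det x y ≡ + suc (r′ + p * r′ + (s + p * suc s) + q * suc s)
        value with combine Xc Xl Xr | combine Yc Yl Yr
        ... | Xx , Xy | Yx , Yy = begin
          X x ℤ.* Y y ℤ.- X y ℤ.* Y x
            ≡⟨ cong₂ ℤ._-_ (cong₂ ℤ._*_ Xx Yy) (cong₂ ℤ._*_ Xy Yx) ⟩
          _ ≡⟨ identity (X a) (Y a) (X b) (Y b) (+ suc p) (+ q) (+ r′) (+ suc s) ⟩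
          (+ suc p ℤ.* + r′ ℤ.+ + suc p ℤ.* + suc s ℤ.+ + q ℤ.* + suc s) ℤ.* det a b
            ≡⟨ cong₂ ℤ._*_ coefficient ab ⟩
          + suc (r′ + p * r′ + (s + p * suc s) + q * suc s) ℤ.* 1ℤ
            ≡⟨ ℤ.*-identityʳ _ ⟩
          + suc (r′ + p * r′ + (s + p * suc s) + q * suc s) ∎
          where open ≡-Reasoning
        unique : r′ + p * r′ + (s + p * suc s) + q * suc s ≡ 0 → D x y
        unique m≡0 with m≤n⇒m<n∨m≡n a≤x | m≤n⇒m<n∨m≡n y≤b
        ... | inj₂ refl | inj₂ refl = D-ab
        ... | inj₁ a<x  | _         = contradiction
          (subst (1 ≤_) m≡0 (≤-trans (*-mono-≤ (q≥1 a<x) (s≤s (z≤n {s}))) (m≤n+m (q * suc s) _))) λ ()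
        ... | inj₂ _    | inj₁ y<b  = contradiction
          (subst (1 ≤_) m≡0 (≤-trans (r≥1 y<b)
            (≤-trans (m≤m+n r′ (p * r′)) (≤-trans (m≤m+n _ (s + p * suc s)) (m≤m+n _ (q * suc s)))))) λ ()

      neighbours : ℕ → ℕ → ℕ → ℕ
      neighbours a b m = ∑[ x < suc N ] 𝟙 ((a ≤? x) ×-dec (x ≤? b) ×-dec D? x m)

      neighbours-apex : ∀ {a c b} → a < c → c < b → b ≤ N → D a c → D c b →
        neighbours a b c ≡ 1 + inDegree a c + (1 + outDegree c b)
      neighbours-apex {a} {c} {b} a<c c<b b≤N ac cb = begin
        neighbours a b c
          ≡⟨ (∑-cong (suc N) λ x _ → trans
               (𝟙-disjoint (all? x) ((x <? c) ×-dec (a ≤? x) ×-dec D? x c) ((c <? x) ×-dec (x ≤? b) ×-dec D? x c)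
                 (λ (a≤x , x≤b , xc) → side-of a≤x x≤b xc)
                 (λ (x<c , a≤x , xc) → a≤x , <⇒≤ (<-trans x<c c<b) , xc)
                 (λ (c<x , x≤b , xc) → <⇒≤ (<-trans a<c c<x) , x≤b , xc)
                 (λ (x<c , _) (c<x , _) → <-asym x<c c<x))
               (cong₂ _+_
                 (𝟙-disjoint ((x <? c) ×-dec (a ≤? x) ×-dec D? x c) (x ≟ a) (in? x)
                   (λ (x<c , a≤x , xc) → first x<c a≤x xc)
                   (λ { refl → a<c , ≤-refl , ac })
                   (λ (a<x , x<c , xc) → x<c , <⇒≤ a<x , xc)
                   (λ { refl (a<a , _) → n≮n a a<a }))
                 (𝟙-disjoint ((c <? x) ×-dec (x ≤? b) ×-dec D? x c) (x ≟ b) (out? x)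
                   (λ (c<x , x≤b , xc) → last c<x x≤b xc)
                   (λ { refl → c<b , ≤-refl , D-sym cb })
                   (λ (c<x , x<b , xc) → c<x , <⇒≤ x<b , xc)
                   (λ { refl (_ , b<b , _) → n≮n b b<b })))) ⟩
        ∑[ x < suc N ] (𝟙 (x ≟ a) + 𝟙 (in? x) + (𝟙 (x ≟ b) + 𝟙 (out? x)))
          ≡⟨ ∑-+ (suc N) (λ x → 𝟙 (x ≟ a) + 𝟙 (in? x)) (λ x → 𝟙 (x ≟ b) + 𝟙 (out? x)) ⟩
        (∑[ x < suc N ] (𝟙 (x ≟ a) + 𝟙 (in? x))) + (∑[ x < suc N ] (𝟙 (x ≟ b) + 𝟙 (out? x)))
          ≡⟨ cong₂ _+_ (trans (∑-+ (suc N) (λ x → 𝟙 (x ≟ a)) (λ x → 𝟙 (in? x)))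
                         (cong (_+ inDegree a c) (∑-δ₁ (s≤s (<⇒≤ (<-≤-trans (<-trans a<c c<b) b≤N))))))
                       (trans (∑-+ (suc N) (λ x → 𝟙 (x ≟ b)) (λ x → 𝟙 (out? x)))
                         (cong (_+ outDegree c b) (∑-δ₁ (s≤s b≤N)))) ⟩
        1 + inDegree a c + (1 + outDegree c b) ∎
        where
        open ≡-Reasoning
        all? : ∀ x → Dec (a ≤ x × x ≤ b × D x c)
        all? x = (a ≤? x) ×-dec (x ≤? b) ×-dec D? x c
        in? : ∀ x → Dec (a < x × x < c × D x c)
        in? x = (a <? x) ×-dec (x <? c) ×-dec D? x c
        out? : ∀ x → Dec (c < x × x < b × D x c)
        out? x = (c <? x) ×-dec (x <? b) ×-dec D? x c
        side-of : ∀ {x} → a ≤ x → x ≤ b → D x c → (x < c × a ≤ x × D x c) ⊎ (c < x × x ≤ b × D x c)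
        side-of {x} a≤x x≤b xc with <-cmp x c
        ... | tri< x<c _ _  = inj₁ (x<c , a≤x , xc)
        ... | tri≈ _ refl _ = contradiction xc D-irrefl
        ... | tri> _ _ c<x  = inj₂ (c<x , x≤b , xc)
        first : ∀ {x} → x < c → a ≤ x → D x c → x ≡ a ⊎ (a < x × x < c × D x c)
        first x<c a≤x xc with m≤n⇒m<n∨m≡n a≤x
        ... | inj₁ a<x = inj₂ (a<x , x<c , xc)
        ... | inj₂ a≡x = inj₁ (sym a≡x)
        last : ∀ {x} → c < x → x ≤ b → D x c → x ≡ b ⊎ (c < x × x < b × D x c)
        last c<x x≤b xc with m≤n⇒m<n∨m≡n x≤b
        ... | inj₁ x<b = inj₂ (c<x , x<b , xc)
        ... | inj₂ x≡b = inj₁ x≡b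

      -- Within a half, the number of neighbours of an interior vertex is the same as in the whole,
      -- since an edge leaving the half would cross `a c` or `c b`; so the recursion descends to the
      -- node whose apex is `suc m`. There the two adjacent labels are those of `a` and `b` plus `i`
      -- and `o` times that of `c`, which gives determinant `1 + i + o`, against `2 + i + o`
      -- neighbours.
      det-neighbours : ∀ {a b} (t : Tree a b) → b ≤ N → Additive X t → Additive Y t → det a b ≡ 1ℤ →
        ∀ {m} → a < suc m → suc m < b → det m (2 + m) ℤ.+ 1ℤ ≡ + neighbours a b (suc m)
      det-neighbours leaf b≤N _ _ _ a<m m<b = contradiction (s≤s⁻¹ m<b) (<⇒≱ a<m)
      det-neighbours (node {a} {c} {b} a<c c<b ac cb l r) b≤N (Xc , Xl , Xr) (Yc , Yl , Yr) ab {m} a<m m<b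
        with <-cmp (suc m) c
      ... | tri< m<c _ _ = trans
        (det-neighbours l (≤-trans (<⇒≤ c<b) b≤N) Xl Yl (trans (det-left Xc Yc) ab) a<m m<c)
        (cong +_ (∑-cong (suc N) λ x _ → 𝟙-cong
          ((a ≤? x) ×-dec (x ≤? c) ×-dec D? x (suc m)) ((a ≤? x) ×-dec (x ≤? b) ×-dec D? x (suc m))
          (λ (a≤x , x≤c , xm) → a≤x , ≤-trans x≤c (<⇒≤ c<b) , xm)
          (λ (a≤x , x≤b , xm) → a≤x , ≮⇒≥ (λ c<x → noncrossing a<m m<c c<x (≤-trans x≤b b≤N) ac (D-sym xm)) , xm)))
      ... | tri> _ _ c<m = trans
        (det-neighbours r b≤N Xr Yr (trans (det-right Xc Yc) ab) c<m m<b)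
        (cong +_ (∑-cong (suc N) λ x _ → 𝟙-cong
          ((c ≤? x) ×-dec (x ≤? b) ×-dec D? x (suc m)) ((a ≤? x) ×-dec (x ≤? b) ×-dec D? x (suc m))
          (λ (c≤x , x≤b , xm) → ≤-trans (<⇒≤ a<c) c≤x , x≤b , xm)
          (λ (a≤x , x≤b , xm) → ≮⇒≥ (λ x<c → noncrossing x<c c<m m<b b≤N xm cb) , x≤b , xm)))
      ... | tri≈ _ refl _ = begin
        det m (2 + m) ℤ.+ 1ℤ
          ≡⟨ cong₂ (λ u v → u ℤ.- v ℤ.+ 1ℤ)
               (cong₂ ℤ._*_ (before-last l c≤N Xl) (after-first r b≤N Yr))
               (cong₂ ℤ._*_ (after-first r b≤N Xr) (before-last l c≤N Yl)) ⟩
        _ ≡⟨ cong (λ u → u ℤ.+ 1ℤ) (trans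
               (cong₂ (λ u v → (X a ℤ.+ i ℤ.* u) ℤ.* (Y b ℤ.+ o ℤ.* v) ℤ.- (X b ℤ.+ o ℤ.* u) ℤ.* (Y a ℤ.+ i ℤ.* v)) Xc Yc)
               (identity (X a) (Y a) (X b) (Y b) i o)) ⟩
        (1ℤ ℤ.+ i ℤ.+ o) ℤ.* det a b ℤ.+ 1ℤ
          ≡⟨ cong (λ u → (1ℤ ℤ.+ i ℤ.+ o) ℤ.* u ℤ.+ 1ℤ) ab ⟩
        (1ℤ ℤ.+ i ℤ.+ o) ℤ.* 1ℤ ℤ.+ 1ℤ
          ≡⟨ collect i o ⟩
        + (1 + inDegree a c + (1 + outDegree c b))
          ≡⟨ cong +_ (neighbours-apex a<c c<b b≤N ac cb) ⟨
        + neighbours a b c ∎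
        where
        open ≡-Reasoning
        c≤N : c ≤ N
        c≤N = ≤-trans (<⇒≤ c<b) b≤N
        i o : ℤ
        i = + inDegree a c
        o = + outDegree c b
        identity : ∀ x y u v i o →
          (x ℤ.+ i ℤ.* (x ℤ.+ u)) ℤ.* (v ℤ.+ o ℤ.* (y ℤ.+ v)) ℤ.- (u ℤ.+ o ℤ.* (x ℤ.+ u)) ℤ.* (y ℤ.+ i ℤ.* (y ℤ.+ v))
          ≡ (1ℤ ℤ.+ i ℤ.+ o) ℤ.* (x ℤ.* v ℤ.- u ℤ.* y)
        identity = ℤ.solve-∀
        collect : ∀ i o → (1ℤ ℤ.+ i ℤ.+ o) ℤ.* 1ℤ ℤ.+ 1ℤ ≡ 1ℤ ℤ.+ i ℤ.+ (1ℤ ℤ.+ o)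
        collect = ℤ.solve-∀

  -- Residues modulo n and the cyclic order of the vertices

  -- An injection given as a relation, so that images need only exist; injectivity is asked of
  -- members only, which lets the noncrossing data be used through membership.
  length-≤ : {A B : Set} {R : A → B → Set} {xs : List A} {ys : List B} → Unique xs →
    (∀ {x} → x ∈ xs → ∃[ y ] y ∈ ys × R x y) →
    (∀ {x x′ y} → x ∈ xs → x′ ∈ xs → R x y → R x′ y → x ≡ x′) →
    length xs ≤ length ys
  length-≤ {xs = []} _ _ _ = z≤n
  length-≤ {R = R} {xs = x ∷ xs} (x∉xs ∷ unique) image injective with image (here refl)
  ... | y , y∈ys , xy with ∈-∃++ y∈ys
  ...   | as , bs , refl = subst (suc (length xs) ≤_) (sym (length-++-sucʳ as y bs))
    (s≤s (length-≤ {R = R} unique image′ λ p q → injective (there p) (there q)))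
    where
    image′ : ∀ {x′} → x′ ∈ xs → ∃[ y′ ] y′ ∈ as ++ bs × R x′ y′
    image′ {x′} x′∈xs with image (there x′∈xs)
    ... | y′ , y′∈ys , x′y′ with ∈-++⁻ as y′∈ys
    ...   | inj₁ y′∈as           = y′ , ∈-++⁺ˡ y′∈as , x′y′
    ...   | inj₂ (there y′∈bs)   = y′ , ∈-++⁺ʳ as y′∈bs , x′y′
    ...   | inj₂ (here refl)     =
      contradiction (injective (here refl) (there x′∈xs) xy x′y′) (All.lookup x∉xs x′∈xs)

  Cyclic : ℕ → ℕ → ℕ → Set
  Cyclic p q r = (p < q × q < r) ⊎ (r < p × p < q) ⊎ (q < r × r < p)

  cyclic-asym : ∀ {p q r} → Cyclic p q r → ¬ Cyclic p r q
  cyclic-asym (inj₁ (p<q , q<r))        (inj₁ (p<r , r<q))        = <-asym q<r r<q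
  cyclic-asym (inj₁ (p<q , q<r))        (inj₂ (inj₁ (q<p , p<r))) = <-asym p<q q<p
  cyclic-asym (inj₁ (p<q , q<r))        (inj₂ (inj₂ (r<q , q<p))) = <-asym p<q q<p
  cyclic-asym (inj₂ (inj₁ (r<p , p<q))) (inj₁ (p<r , r<q))        = <-asym r<p p<r
  cyclic-asym (inj₂ (inj₁ (r<p , p<q))) (inj₂ (inj₁ (q<p , p<r))) = <-asym r<p p<r
  cyclic-asym (inj₂ (inj₁ (r<p , p<q))) (inj₂ (inj₂ (r<q , q<p))) = <-asym p<q q<p
  cyclic-asym (inj₂ (inj₂ (q<r , r<p))) (inj₁ (p<r , r<q))        = <-asym r<p p<r
  cyclic-asym (inj₂ (inj₂ (q<r , r<p))) (inj₂ (inj₁ (q<p , p<r))) = <-asym r<p p<r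
  cyclic-asym (inj₂ (inj₂ (q<r , r<p))) (inj₂ (inj₂ (r<q , q<p))) = <-asym q<r r<q

  cyclic-≢ : ∀ {p q r} → Cyclic p q r → p ≢ q × q ≢ r × p ≢ r
  cyclic-≢ (inj₁ (p<q , q<r))        = <⇒≢ p<q , <⇒≢ q<r , <⇒≢ (<-trans p<q q<r)
  cyclic-≢ (inj₂ (inj₁ (r<p , p<q))) = <⇒≢ p<q , ≢-sym (<⇒≢ (<-trans r<p p<q)) , ≢-sym (<⇒≢ r<p)
  cyclic-≢ (inj₂ (inj₂ (q<r , r<p))) = ≢-sym (<⇒≢ (<-trans q<r r<p)) , <⇒≢ q<r , ≢-sym (<⇒≢ r<p)

  +-suc-ℤ : ∀ i p → i ℤ.+ + p ℤ.+ 1ℤ ≡ i ℤ.+ + suc p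
  +-suc-ℤ i p = trans (ℤ.+-assoc i (+ p) 1ℤ) (cong (λ t → i ℤ.+ + t) (+-comm p 1))

  +-suc-ℤʳ : ∀ i p → i ℤ.+ 1ℤ ℤ.+ + p ≡ i ℤ.+ + suc p
  +-suc-ℤʳ i p = ℤ.+-assoc i 1ℤ (+ p)

  module _ {n : ℕ} .{{_ : NonZero n}} where

    -- Otherwise `s - r` would be a multiple of `n` strictly between `0` and `n`.
    residues-differ : ∀ {r s} p q → s < n → r < s → + s ℤ.+ p ℤ.* + n ≢ + r ℤ.+ q ℤ.* + n
    residues-differ {r} {s} p q s<n r<s eq =
      ℕ.>⇒∤ {{>-nonZero (m<n⇒0<n∸m r<s)}} (≤-<-trans (m∸n≤m s r) s<n)
        (ℕ.divides ℤ.∣ q ℤ.- p ∣ (trans (cong ℤ.∣_∣ difference) (ℤ.abs-* (q ℤ.- p) (+ n))))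
      where
      insert : ∀ a b c → a ≡ a ℤ.+ b ℤ.+ c ℤ.- (b ℤ.+ c)
      insert = ℤ.solve-∀
      factor : ∀ a b c d → a ℤ.+ b ℤ.* d ℤ.- (a ℤ.+ c ℤ.* d) ≡ (b ℤ.- c) ℤ.* d
      factor = ℤ.solve-∀
      difference : + (s ∸ r) ≡ (q ℤ.- p) ℤ.* + n
      difference = begin
        + (s ∸ r)
          ≡⟨ insert (+ (s ∸ r)) (+ r) (p ℤ.* + n) ⟩
        + (s ∸ r + r) ℤ.+ p ℤ.* + n ℤ.- (+ r ℤ.+ p ℤ.* + n)
          ≡⟨ cong (λ t → + t ℤ.+ p ℤ.* + n ℤ.- (+ r ℤ.+ p ℤ.* + n)) (m∸n+n≡m (<⇒≤ r<s)) ⟩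
        + s ℤ.+ p ℤ.* + n ℤ.- (+ r ℤ.+ p ℤ.* + n)
          ≡⟨ cong (ℤ._- (+ r ℤ.+ p ℤ.* + n)) eq ⟩
        + r ℤ.+ q ℤ.* + n ℤ.- (+ r ℤ.+ p ℤ.* + n)
          ≡⟨ factor (+ r) q p (+ n) ⟩
        (q ℤ.- p) ℤ.* + n ∎
        where open ≡-Reasoning

    residue-unique : ∀ {u r} q → r < n → u ≡ + r ℤ.+ q ℤ.* + n → u %ℕ n ≡ r
    residue-unique {u} {r} q r<n eq with <-cmp (u %ℕ n) r
    ... | tri≈ _ s≡r _ = s≡r
    ... | tri< s<r _ _ = contradiction (trans (sym eq) (a≡a%ℕn+[a/ℕn]*n u n)) (residues-differ q (u /ℕ n) r<n s<r)
    ... | tri> _ _ r<s = contradiction (trans (sym (a≡a%ℕn+[a/ℕn]*n u n)) eq) (residues-differ (u /ℕ n) q (n%ℕd<d u n) r<s)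

    toℕ-v : ∀ u → toℕ (v {n} u) ≡ u %ℕ n
    toℕ-v u = Fin.toℕ-fromℕ< (n%ℕd<d u n)

    v-below : ∀ u p → u %ℕ n + p < n → toℕ (v {n} (u ℤ.+ + p)) ≡ u %ℕ n + p
    v-below u p r+p<n = trans (toℕ-v (u ℤ.+ + p)) (residue-unique (u /ℕ n) r+p<n (begin
      u ℤ.+ + p                                           ≡⟨ cong (ℤ._+ + p) (a≡a%ℕn+[a/ℕn]*n u n) ⟩
      + (u %ℕ n) ℤ.+ (u /ℕ n) ℤ.* + n ℤ.+ + p             ≡⟨ shuffle (+ (u %ℕ n)) ((u /ℕ n) ℤ.* + n) (+ p) ⟩
      + (u %ℕ n + p) ℤ.+ (u /ℕ n) ℤ.* + n                 ∎))
      where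
      open ≡-Reasoning
      shuffle : ∀ a b c → a ℤ.+ b ℤ.+ c ≡ a ℤ.+ c ℤ.+ b
      shuffle = ℤ.solve-∀

    v-above : ∀ u p → n ≤ u %ℕ n + p → p ≤ n → toℕ (v {n} (u ℤ.+ + p)) + n ≡ u %ℕ n + p
    v-above u p n≤r+p p≤n = trans (cong (_+ n) (trans (toℕ-v (u ℤ.+ + p))
      (residue-unique ((u /ℕ n) ℤ.+ 1ℤ) s<n (begin
        u ℤ.+ + p                                             ≡⟨ cong (ℤ._+ + p) (a≡a%ℕn+[a/ℕn]*n u n) ⟩
        + (u %ℕ n) ℤ.+ (u /ℕ n) ℤ.* + n ℤ.+ + p               ≡⟨ shuffle (+ (u %ℕ n)) ((u /ℕ n) ℤ.* + n) (+ p) ⟩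
        + (u %ℕ n + p) ℤ.+ (u /ℕ n) ℤ.* + n                   ≡⟨ cong (λ t → + t ℤ.+ (u /ℕ n) ℤ.* + n) (m∸n+n≡m n≤r+p) ⟨
        + s ℤ.+ + n ℤ.+ (u /ℕ n) ℤ.* + n                      ≡⟨ factor (+ s) (+ n) (u /ℕ n) ⟩
        + s ℤ.+ ((u /ℕ n) ℤ.+ 1ℤ) ℤ.* + n                     ∎)))) (m∸n+n≡m n≤r+p)
      where
      open ≡-Reasoning
      s : ℕ
      s = u %ℕ n + p ∸ n
      s<n : s < n
      s<n = +-cancelʳ-< n s n (subst (_< n + n) (sym (m∸n+n≡m n≤r+p)) (+-mono-<-≤ (n%ℕd<d u n) p≤n))
      shuffle : ∀ a b c → a ℤ.+ b ℤ.+ c ≡ a ℤ.+ c ℤ.+ b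
      shuffle = ℤ.solve-∀
      factor : ∀ a b c → a ℤ.+ b ℤ.+ c ℤ.* b ≡ a ℤ.+ (c ℤ.+ 1ℤ) ℤ.* b
      factor = ℤ.solve-∀

    v-periodic : ∀ u → v {n} (u ℤ.+ + n) ≡ v u
    v-periodic u = Fin.toℕ-injective (trans
      (+-cancelʳ-≡ n _ _ (v-above u n (m≤n+m n (u %ℕ n)) ≤-refl)) (sym (toℕ-v u)))

    v-next : ∀ u → Next {n} (v u) (v (u ℤ.+ 1ℤ))
    v-next u with suc (u %ℕ n) <? n
    ... | yes r<n = trans (v-below u 1 (subst (_< n) (+-comm 1 (u %ℕ n)) r<n))
      (trans (+-comm (u %ℕ n) 1) (sym (trans (cong (λ t → suc t % n) (toℕ-v u)) (m<n⇒m%n≡m r<n))))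
    ... | no r≮n = trans
      (+-cancelʳ-≡ n _ _ (trans (v-above u 1 (≤-reflexive (sym r+1≡n)) (>-nonZero⁻¹ n)) r+1≡n))
      (sym (trans (cong (λ t → suc t % n) (toℕ-v u)) (trans (cong (_% n) (trans (+-comm 1 _) r+1≡n)) (n%n≡0 n))))
      where
      r+1≡n : u %ℕ n + 1 ≡ n
      r+1≡n = trans (+-comm (u %ℕ n) 1) (≤-antisym (n%ℕd<d u n) (≮⇒≥ r≮n))

    next-unique : ∀ {x y z : Fin n} → Next x y → Next x z → y ≡ z
    next-unique xy xz = Fin.toℕ-injective (trans xy (sym xz))

    -- Windows of consecutive vertices.

    module Window (i : ℤ) where

      vertex : ℕ → Fin n
      vertex p = v (i ℤ.+ + p)

      position : ℕ → ℕ
      position p = toℕ (vertex p)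

      private
        r : ℕ
        r = i %ℕ n

      -- Along a window the residues rise, fall back at most once, and rise again; the wrapped
      -- indices are those past the fall.
      Wrapped : ℕ → Set
      Wrapped p = n ≤ r + p

      wrapped-mono : ∀ {p q} → p < q → Wrapped p → Wrapped q
      wrapped-mono p<q w = ≤-trans w (+-monoʳ-≤ r (<⇒≤ p<q))

      unwrapped-mono : ∀ {p q} → p < q → ¬ Wrapped q → ¬ Wrapped p
      unwrapped-mono p<q ¬w w = ¬w (wrapped-mono p<q w)

      position-unwrapped : ∀ {p q} → p < q → ¬ Wrapped q → position p < position q
      position-unwrapped {p} {q} p<q ¬w = subst₂ _<_
        (sym (v-below i p (≰⇒> (unwrapped-mono p<q ¬w)))) (sym (v-below i q (≰⇒> ¬w))) (+-monoʳ-< r p<q)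

      position-wrapped : ∀ {p q} → p < q → q < n → Wrapped p → position p < position q
      position-wrapped {p} {q} p<q q<n w = +-cancelʳ-< n _ _ (subst₂ _<_
        (sym (v-above i p w (<⇒≤ (<-trans p<q q<n)))) (sym (v-above i q (wrapped-mono p<q w) (<⇒≤ q<n)))
        (+-monoʳ-< r p<q))

      -- Residues before the fall are at least `r`, those after it are below `r`.
      position-across : ∀ {p q} → q < n → ¬ Wrapped p → Wrapped q → position q < position p
      position-across {p} {q} q<n ¬w w = +-cancelʳ-< n _ _ (begin-strict
        position q + n ≡⟨ v-above i q w (<⇒≤ q<n) ⟩
        r + q          <⟨ +-monoʳ-< r q<n ⟩
        r + n          ≤⟨ +-monoˡ-≤ n (m≤m+n r p) ⟩
        r + p + n      ≡⟨ cong (_+ n) (v-below i p (≰⇒> ¬w)) ⟨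
        position p + n ∎)
        where open ≤-Reasoning

      position-≢ : ∀ {p q} → p < q → q < n → position p ≢ position q
      position-≢ {p} {q} p<q q<n with n ≤? r + p | n ≤? r + q
      ... | yes w | _      = <⇒≢ (position-wrapped p<q q<n w)
      ... | no _  | no ¬w  = <⇒≢ (position-unwrapped p<q ¬w)
      ... | no ¬w | yes w  = ≢-sym (<⇒≢ (position-across q<n ¬w w))

      vertex-injective : ∀ {p q} → p < n → q < n → vertex p ≡ vertex q → p ≡ q
      vertex-injective {p} {q} p<n q<n eq with <-cmp p q
      ... | tri< p<q _ _ = contradiction (cong toℕ eq) (position-≢ p<q q<n)
      ... | tri≈ _ p≡q _ = p≡q
      ... | tri> _ _ q<p = contradiction (sym (cong toℕ eq)) (position-≢ q<p p<n)

      vertex-surjective : ∀ x → ∃[ p ] p < n × vertex p ≡ x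
      vertex-surjective x with r ≤? toℕ x
      ... | yes r≤x = toℕ x ∸ r , ≤-<-trans (m∸n≤m (toℕ x) r) (Fin.toℕ<n x) ,
        Fin.toℕ-injective (trans (v-below i _ (subst (_< n) (sym sum) (Fin.toℕ<n x))) sum)
        where
        sum : r + (toℕ x ∸ r) ≡ toℕ x
        sum = m+[n∸m]≡n r≤x
      ... | no r≰x = toℕ x + (n ∸ r) , p<n ,
        Fin.toℕ-injective (+-cancelʳ-≡ n _ _ (trans (v-above i _ (subst (n ≤_) (sym sum) (m≤n+m n (toℕ x))) (<⇒≤ p<n)) sum))
        where
        r≤n : r ≤ n
        r≤n = <⇒≤ (n%ℕd<d i n)
        p<n : toℕ x + (n ∸ r) < n
        p<n = subst (toℕ x + (n ∸ r) <_) (m+[n∸m]≡n r≤n) (+-monoˡ-< (n ∸ r) (≰⇒> r≰x))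
        sum : r + (toℕ x + (n ∸ r)) ≡ toℕ x + n
        sum = begin
          r + (toℕ x + (n ∸ r)) ≡⟨ swap r (toℕ x) (n ∸ r) ⟩
          toℕ x + (r + (n ∸ r)) ≡⟨ cong (λ t → toℕ x + t) (m+[n∸m]≡n r≤n) ⟩
          toℕ x + n             ∎
          where
          open ≡-Reasoning
          swap : ∀ a b c → a + (b + c) ≡ b + (a + c)
          swap = ℕ.solve-∀

      cyclic-order : ∀ {p q s} → p < q → q < s → s < n → Cyclic (position p) (position q) (position s)
      cyclic-order {p} {q} {s} p<q q<s s<n with n ≤? r + p | n ≤? r + q | n ≤? r + s
      ... | yes w | _      | _     = inj₁ (position-wrapped p<q (<-trans q<s s<n) w , position-wrapped q<s s<n (wrapped-mono p<q w))
      ... | no _  | _      | no ¬w = inj₁ (position-unwrapped p<q (unwrapped-mono q<s ¬w) , position-unwrapped q<s ¬w)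
      ... | no ¬p | yes w  | yes _ = inj₂ (inj₂ (position-wrapped q<s s<n w , position-across s<n ¬p (wrapped-mono q<s w)))
      ... | no ¬p | no ¬q  | yes w = inj₂ (inj₁ (position-across s<n ¬p w , position-unwrapped p<q ¬q))

      vertex-suc : ∀ p → v {n} (i ℤ.+ + p ℤ.+ 1ℤ) ≡ vertex (suc p)
      vertex-suc p = cong v (+-suc-ℤ i p)

      vertex-next : ∀ p → Next (vertex p) (vertex (suc p))
      vertex-next p = subst (Next (vertex p)) (vertex-suc p) (v-next (i ℤ.+ + p))

      vertex-n : vertex n ≡ vertex 0
      vertex-n = trans (v-periodic i) (cong v (sym (ℤ.+-identityʳ i)))

      -- Successors are unique: either `q` follows `p`, or `p` follows `q`, which with `p < q`
      -- happens only where the window closes up. The second alternative is the base edge.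
      side-positions : ∀ {p q} → p < q → q < n → Side (vertex p) (vertex q) → q ≡ suc p ⊎ (p ≡ 0 × suc q ≡ n)
      side-positions {p} {q} p<q q<n (inj₁ next) =
        inj₁ (vertex-injective q<n (≤-<-trans p<q q<n) (next-unique next (vertex-next p)))
      side-positions {p} {q} p<q q<n (inj₂ next) with m≤n⇒m<n∨m≡n q<n
      ... | inj₁ 1+q<n = contradiction
        (vertex-injective (<-trans p<q q<n) 1+q<n (next-unique next (vertex-next q)))
        (<⇒≢ (m<n⇒m<1+n p<q))
      ... | inj₂ refl = inj₂ (vertex-injective (<-trans p<q q<n) z<s
        (trans (next-unique next (vertex-next q)) vertex-n) , refl)

  -- Counting in lists

  count-filter-∷ : {A : Set} {P : A → Set} (P? : ∀ x → Dec (P x)) (x : A) (xs : List A) →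
    count P? (x ∷ xs) ≡ 𝟙 (P? x) + count P? xs
  count-filter-∷ P? x xs with does (P? x)
  ... | true  = refl
  ... | false = refl

  count-++ : {A : Set} {P : A → Set} (P? : ∀ x → Dec (P x)) (xs ys : List A) →
    count P? (xs ++ ys) ≡ count P? xs + count P? ys
  count-++ P? []       ys = refl
  count-++ P? (x ∷ xs) ys = trans (count-filter-∷ P? x (xs ++ ys))
    (trans (cong (λ m → 𝟙 (P? x) + m) (count-++ P? xs ys))
      (trans (sym (+-assoc (𝟙 (P? x)) _ _)) (cong (_+ count P? ys) (sym (count-filter-∷ P? x xs)))))

  count-map : {A B : Set} {P : B → Set} (P? : ∀ x → Dec (P x)) (f : A → B) (xs : List A) →
    count P? (map f xs) ≡ count (P? ∘ f) xs
  count-map P? f []       = refl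
  count-map P? f (x ∷ xs) = trans (count-filter-∷ P? (f x) (map f xs))
    (trans (cong (λ m → 𝟙 (P? (f x)) + m) (count-map P? f xs)) (sym (count-filter-∷ (P? ∘ f) x xs)))

  count-applyUpTo : {A : Set} {P : A → Set} (P? : ∀ x → Dec (P x)) (f : ℕ → A) (n : ℕ) →
    count P? (applyUpTo f n) ≡ ∑[ i < n ] 𝟙 (P? (f i))
  count-applyUpTo P? f zero    = refl
  count-applyUpTo P? f (suc n) = trans (count-filter-∷ P? (f 0) (applyUpTo (f ∘ suc) n))
    (trans (cong (λ m → 𝟙 (P? (f 0)) + m) (count-applyUpTo P? (f ∘ suc) n)) (sym (∑-suc n (λ i → 𝟙 (P? (f i))))))

  count-cartesianProduct : {A B : Set} {P : A × B → Set} (P? : ∀ x → Dec (P x))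
    (f : ℕ → A) (g : ℕ → B) (m n : ℕ) →
    count P? (cartesianProduct (applyUpTo f m) (applyUpTo g n)) ≡ ∑[ i < m ] ∑[ j < n ] 𝟙 (P? (f i , g j))
  count-cartesianProduct P? f g zero    n = refl
  count-cartesianProduct P? f g (suc m) n = begin
    count P? (map (f 0 ,_) ys ++ cartesianProduct (applyUpTo (f ∘ suc) m) ys)
      ≡⟨ count-++ P? (map (f 0 ,_) ys) _ ⟩
    count P? (map (f 0 ,_) ys) + count P? (cartesianProduct (applyUpTo (f ∘ suc) m) ys)
      ≡⟨ cong₂ _+_ (trans (count-map P? (f 0 ,_) ys) (count-applyUpTo (P? ∘ (f 0 ,_)) g n))
           (count-cartesianProduct P? (f ∘ suc) g m n) ⟩
    (∑[ j < n ] 𝟙 (P? (f 0 , g j))) + (∑[ i < m ] ∑[ j < n ] 𝟙 (P? (f (suc i) , g j)))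
      ≡⟨ ∑-suc m (λ i → ∑[ j < n ] 𝟙 (P? (f i , g j))) ⟨
    ∑[ i < suc m ] ∑[ j < n ] 𝟙 (P? (f i , g j)) ∎
    where
    open ≡-Reasoning
    ys : List _
    ys = applyUpTo g n

  map-applyUpTo : {A B : Set} (h : A → B) (f : ℕ → A) (n : ℕ) →
    map h (applyUpTo f n) ≡ applyUpTo (h ∘ f) n
  map-applyUpTo h f zero    = refl
  map-applyUpTo h f (suc n) = cong (h (f 0) ∷_) (map-applyUpTo h (f ∘ suc) n)

  count-≤ : {A B : Set} {P : A → Set} {Q : B → Set} {R : A → B → Set}
    (P? : ∀ x → Dec (P x)) (Q? : ∀ y → Dec (Q y)) {xs : List A} {ys : List B} → Unique xs →
    (∀ {x} → x ∈ xs → P x → ∃[ y ] y ∈ ys × Q y × R x y) →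
    (∀ {x x′ y} → R x y → R x′ y → x ≡ x′) →
    count P? xs ≤ count Q? ys
  count-≤ {R = R} P? Q? {xs} {ys} unique image injective =
    length-≤ {R = R} (Unique.filter⁺ P? unique) image′ λ _ _ → injective
    where
    image′ : ∀ {x} → x ∈ filter P? xs → ∃[ y ] y ∈ filter Q? ys × R x y
    image′ x∈ with ∈-filter⁻ P? {xs = xs} x∈
    ... | x∈xs , px with image x∈xs px
    ...   | y , y∈ys , qy , xy = y , ∈-filter⁺ Q? y∈ys qy , xy

  range-length : ∀ i m → i ℤ.+ + m ℤ.+ 1ℤ ℤ.- i ≡ + suc m
  range-length i m = identity i (+ m)
    where
    identity : ∀ i m → i ℤ.+ m ℤ.+ 1ℤ ℤ.- i ≡ 1ℤ ℤ.+ m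
    identity = ℤ.solve-∀

  range-applyUpTo : ∀ i m → range i (i ℤ.+ + m) ≡ applyUpTo (λ t → i ℤ.+ + t) (suc m)
  range-applyUpTo i m rewrite range-length i m = map-applyUpTo (λ t → i ℤ.+ + t) (λ t → t) (suc m)

  -- Triangulated polygons

  module Triangulated {k : ℕ} (𝕋 : Triangulation (3 + k)) where

    open Triangulation 𝕋

    private
      n N : ℕ
      n = 3 + k
      N = 2 + k

    Edge-sym : ∀ {x y} → Edge 𝕋 x y → Edge 𝕋 y x
    Edge-sym (inj₁ side)     = inj₁ (Sum.swap side)
    Edge-sym (inj₂ diagonal) = inj₂ (Sum.swap diagonal)

    ¬Next-refl : ∀ (x : Fin n) → ¬ Next x x
    ¬Next-refl x next with m≤n⇒m<n∨m≡n (Fin.toℕ<n x)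
    ... | inj₁ x<n = contradiction (trans next (m<n⇒m%n≡m x<n)) (<⇒≢ ≤-refl)
    ... | inj₂ x≡n = contradiction
      (trans (sym (suc-injective x≡n)) (trans next (trans (cong (_% n) x≡n) (n%n≡0 n)))) λ ()

    Diagonal⇒¬Side : ∀ {x y} → Diagonal 𝕋 x y → ¬ Side x y
    Diagonal⇒¬Side (inj₁ d) side = proj₂ (All.lookup isDiagonal d) side
    Diagonal⇒¬Side (inj₂ d) side = proj₂ (All.lookup isDiagonal d) (Sum.swap side)

    Edge-irrefl : ∀ {x} → ¬ Edge 𝕋 x x
    Edge-irrefl {x} (inj₁ (inj₁ next)) = ¬Next-refl x next
    Edge-irrefl {x} (inj₁ (inj₂ next)) = ¬Next-refl x next
    Edge-irrefl (inj₂ (inj₁ d)) = n≮n _ (proj₁ (All.lookup isDiagonal d))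
    Edge-irrefl (inj₂ (inj₂ d)) = n≮n _ (proj₁ (All.lookup isDiagonal d))

    diagonal-∈ : ∀ {x y} → x Fin.< y → Diagonal 𝕋 x y → (x , y) ∈ diagonals
    diagonal-∈ x<y (inj₁ d) = d
    diagonal-∈ x<y (inj₂ d) = contradiction (proj₁ (All.lookup isDiagonal d)) (<-asym x<y)

    diagonals-noncrossing : ∀ {x y z w} → x Fin.< z → z Fin.< y → y Fin.< w →
      Diagonal 𝕋 x y → ¬ Diagonal 𝕋 z w
    diagonals-noncrossing x<z z<y y<w xy zw = nonCrossing
      (diagonal-∈ (<-trans x<z z<y) xy) (diagonal-∈ (<-trans z<y y<w) zw) (inj₁ (x<z , z<y , y<w))

    -- A triangulation seen through a window.

    module TriangulatedWindow (i : ℤ) where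

      open Window {n} i public

      D : ℕ → ℕ → Set
      D p q = Edge 𝕋 (vertex p) (vertex q)

      D? : ∀ p q → Dec (D p q)
      D? p q = Edge? 𝕋 (vertex p) (vertex q)

      -- A side has no index between its ends or, as the base edge, none outside them. For two
      -- diagonals the five cases say where the residues fall back among `a < c < b < d`; each
      -- rotates the alternating quadruple into increasing order.
      noncrossing : ∀ {a b c d} → a < c → c < b → b < d → d ≤ N → D a b → D c d → ⊥
      noncrossing {a} {b} {c} {d} a<c c<b b<d d≤N (inj₁ ab) _
        with side-positions (<-trans a<c c<b) (s≤s (≤-trans (<⇒≤ b<d) d≤N)) ab
      ... | inj₁ refl        = <⇒≱ c<b a<c
      ... | inj₂ (_ , refl)  = <⇒≱ b<d d≤N
      noncrossing {a} {b} {c} {d} a<c c<b b<d d≤N (inj₂ _) (inj₁ cd)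
        with side-positions (<-trans c<b b<d) (s≤s d≤N) cd
      ... | inj₁ refl        = <⇒≱ b<d c<b
      ... | inj₂ (refl , _)  = n≮0 a<c
      noncrossing {a} {b} {c} {d} a<c c<b b<d d≤N (inj₂ ab) (inj₂ cd) = cases
        where
        d<n : d < n
        d<n = s≤s d≤N
        b<n : b < n
        b<n = <-trans b<d d<n
        c<n : c < n
        c<n = <-trans c<b b<n
        cases : ⊥
        cases with n ≤? i %ℕ n + a | n ≤? i %ℕ n + c | n ≤? i %ℕ n + b | n ≤? i %ℕ n + d
        ... | yes w | _ | _ | _ = diagonals-noncrossing (position-wrapped a<c c<n w)
          (position-wrapped c<b b<n (wrapped-mono a<c w))
          (position-wrapped b<d d<n (wrapped-mono (<-trans a<c c<b) w)) ab cd
        ... | no ¬a | yes w | _ | _ = diagonals-noncrossing (position-wrapped c<b b<n w)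
          (position-wrapped b<d d<n (wrapped-mono c<b w))
          (position-across d<n ¬a (wrapped-mono (<-trans c<b b<d) w)) cd (Sum.swap ab)
        ... | no ¬a | no ¬c | yes w | _ = diagonals-noncrossing (position-wrapped b<d d<n w)
          (position-across d<n ¬a (wrapped-mono b<d w)) (position-unwrapped a<c ¬c) (Sum.swap ab) (Sum.swap cd)
        ... | no ¬a | no ¬c | no ¬b | yes w = diagonals-noncrossing (position-across d<n ¬a w)
          (position-unwrapped a<c ¬c) (position-unwrapped c<b ¬b) (Sum.swap cd) ab
        ... | no _ | no _ | no _ | no ¬d = diagonals-noncrossing
          (position-unwrapped a<c (unwrapped-mono (<-trans c<b b<d) ¬d))
          (position-unwrapped c<b (unwrapped-mono b<d ¬d)) (position-unwrapped b<d ¬d) ab cd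

      base-edge : D 0 N
      base-edge = inj₁ (inj₂ (subst (Next (vertex N)) vertex-n (vertex-next N)))

      open Chords N D D? Edge-sym Edge-irrefl (λ {p} _ → inj₁ (inj₁ (vertex-next p))) noncrossing public

      Realises : Fin n × Fin n → ℕ × ℕ → Set
      Realises (x , y) (p , q) = (vertex p ≡ x × vertex q ≡ y) ⊎ (vertex p ≡ y × vertex q ≡ x)

      base : Fin n × Fin n
      base = vertex N , vertex 0

      -- The `k` diagonals and the base edge are different segments, and each is a chord of the
      -- window.
      chords-many : suc k ≤ chords 0 N
      chords-many = begin
        suc k                     ≡⟨ cong suc number ⟨
        length (base ∷ diagonals) ≤⟨ length-≤ {R = Realises} unique image injective ⟩
        length inside             ≡⟨ count-cartesianProduct (λ (p , q) → Inside? 0 N p q) (λ p → p) (λ p → p) n n ⟩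
        chords 0 N                ∎
        where
        open ≤-Reasoning
        inside : List (ℕ × ℕ)
        inside = filter (λ (p , q) → Inside? 0 N p q) (cartesianProduct (upTo n) (upTo n))
        base-side : Side (vertex N) (vertex 0)
        base-side = inj₁ (subst (Next (vertex N)) vertex-n (vertex-next N))
        unique : Unique (base ∷ diagonals)
        unique = All.tabulate (λ { d∈ refl → Diagonal⇒¬Side (inj₁ d∈) base-side }) ∷ distinct
        member : ∀ {p q} → p < n → q < n → 2 + p ≤ q → D p q → (p , q) ∈ inside
        member p<n q<n p<q pq = ∈-filter⁺ (λ (p , q) → Inside? 0 N p q)
          (∈-cartesianProduct⁺ (∈-upTo⁺ p<n) (∈-upTo⁺ q<n)) (z≤n , p<q , s≤s⁻¹ q<n , pq)
        gap : ∀ {p q} → p < q → Diagonal 𝕋 (vertex p) (vertex q) → 2 + p ≤ q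
        gap {p} p<q d with m≤n⇒m<n∨m≡n p<q
        ... | inj₁ 1+p<q = 1+p<q
        ... | inj₂ refl  = contradiction (inj₁ (vertex-next p)) (Diagonal⇒¬Side d)
        image : ∀ {d} → d ∈ base ∷ diagonals → ∃[ pq ] pq ∈ inside × Realises d pq
        image (here refl) = (0 , N) , member z<s ≤-refl (s≤s (s≤s z≤n)) base-edge , inj₂ (refl , refl)
        image {x , y} (there d∈) with vertex-surjective x | vertex-surjective y
        ... | p , p<n , refl | q , q<n , refl with <-cmp p q
        ...   | tri< p<q _ _ = (p , q) , member p<n q<n (gap p<q (inj₁ d∈)) (inj₂ (inj₁ d∈)) , inj₁ (refl , refl)
        ...   | tri≈ _ refl _ = contradiction (inj₂ (inj₁ d∈)) Edge-irrefl
        ...   | tri> _ _ q<p = (q , p) , member q<n p<n (gap q<p (inj₂ d∈)) (inj₂ (inj₂ d∈)) , inj₂ (refl , refl)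
        -- No segment is listed in both directions: a diagonal has its smaller endpoint first, and
        -- the base edge is a side.
        opposite : ∀ {x y} → (x , y) ∈ base ∷ diagonals → (y , x) ∈ base ∷ diagonals → (x , y) ≡ (y , x)
        opposite (here refl) (here eq)   = sym eq
        opposite (here refl) (there d∈)  = contradiction base-side (Diagonal⇒¬Side (inj₂ d∈))
        opposite (there d∈)  (here refl) = contradiction base-side (Diagonal⇒¬Side (inj₂ d∈))
        opposite (there d∈)  (there e∈)  =
          contradiction (proj₁ (All.lookup isDiagonal d∈)) (<-asym (proj₁ (All.lookup isDiagonal e∈)))
        injective : ∀ {d e pq} → d ∈ base ∷ diagonals → e ∈ base ∷ diagonals →
          Realises d pq → Realises e pq → d ≡ e
        injective d∈ e∈ (inj₁ (refl , refl)) (inj₁ (refl , refl)) = refl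
        injective d∈ e∈ (inj₂ (refl , refl)) (inj₂ (refl , refl)) = refl
        injective d∈ e∈ (inj₁ (refl , refl)) (inj₂ (refl , refl)) = opposite d∈ e∈
        injective d∈ e∈ (inj₂ (refl , refl)) (inj₁ (refl , refl)) = opposite d∈ e∈

      -- Abstract, as chords-bound would otherwise be unfolded N times by later with-abstractions.
      abstract
        tight : chords 0 N ≡ suc k × Tree 0 N
        tight = chords-total , proj₂ (proj₂ bound (≤-reflexive (sym (trans (+-comm (chords 0 N) 1) (cong suc chords-total)))))
          where
          bound : chords 0 N + 1 ≤ N × (N ≤ chords 0 N + 1 → D 0 N × Tree 0 N)
          bound = chords-bound N z<s ≤-refl (m≤m+n N 0)
          chords-total : chords 0 N ≡ suc k
          chords-total = ≤-antisym (s≤s⁻¹ (subst (_≤ N) (+-comm (chords 0 N) 1) (proj₁ bound))) chords-many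

      chords-total : chords 0 N ≡ suc k
      chords-total = proj₁ tight

      tree : Tree 0 N
      tree = proj₂ tight

      -- Cells at a vertex.

      Sorted : Fin n × Fin n × Fin n → Set
      Sorted (x , y , z) = x Fin.< y × y Fin.< z

      Rotation : Fin n → Fin n → Fin n → Fin n × Fin n × Fin n → Set
      Rotation x y z t = t ≡ (x , y , z) ⊎ t ≡ (z , x , y) ⊎ t ≡ (y , z , x)

      -- t lists in increasing order the vertices 0, middle and q of a cell; since middle
      -- is the apex of the chord 0 q, this is a bijection between the cells at vertex 0
      -- and the edges 0 q with q ≥ 2.
      record CellWithLast (q : ℕ) (t : Fin n × Fin n × Fin n) : Set where
        constructor cellWithLast
        field
          middle   : ℕ
          0<middle : 0 < middle
          middle<q : middle < q
          q<n      : q < n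
          first-edge : D 0 middle
          last-edge  : D middle q
          closing-edge : D 0 q
          sorted   : Sorted t
          rotation : Rotation (vertex 0) (vertex middle) (vertex q) t

      rotation-unique : ∀ {x y z t t′} → Rotation x y z t → Sorted t → Rotation x y z t′ → Sorted t′ → t ≡ t′
      rotation-unique (inj₁ refl)        _ (inj₁ refl)        _ = refl
      rotation-unique (inj₂ (inj₁ refl)) _ (inj₂ (inj₁ refl)) _ = refl
      rotation-unique (inj₂ (inj₂ refl)) _ (inj₂ (inj₂ refl)) _ = refl
      rotation-unique (inj₁ refl) (p , q) (inj₂ (inj₁ refl)) (r , _) = contradiction (<-trans p q) (<-asym r)
      rotation-unique (inj₁ refl) (p , q) (inj₂ (inj₂ refl)) (_ , r) = contradiction (<-trans p q) (<-asym r)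
      rotation-unique (inj₂ (inj₁ refl)) (r , _) (inj₁ refl) (p , q) = contradiction (<-trans p q) (<-asym r)
      rotation-unique (inj₂ (inj₁ refl)) (p , q) (inj₂ (inj₂ refl)) (r , _) = contradiction (<-trans p q) (<-asym r)
      rotation-unique (inj₂ (inj₂ refl)) (_ , r) (inj₁ refl) (p , q) = contradiction (<-trans p q) (<-asym r)
      rotation-unique (inj₂ (inj₂ refl)) (r , _) (inj₂ (inj₁ refl)) (p , q) = contradiction (<-trans p q) (<-asym r)

      rotation-last : ∀ {x y z y′ z′ t} → x ≢ y′ → x ≢ z′ →
        Rotation x y z t → Rotation x y′ z′ t → z ≡ z′
      rotation-last _ _ (inj₁ refl)        (inj₁ refl)        = refl
      rotation-last _ _ (inj₂ (inj₁ refl)) (inj₂ (inj₁ refl)) = refl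
      rotation-last _ _ (inj₂ (inj₂ refl)) (inj₂ (inj₂ refl)) = refl
      rotation-last _ h (inj₁ refl)        (inj₂ (inj₁ refl)) = contradiction refl h
      rotation-last h _ (inj₁ refl)        (inj₂ (inj₂ refl)) = contradiction refl h
      rotation-last h _ (inj₂ (inj₁ refl)) (inj₁ refl)        = contradiction refl h
      rotation-last _ h (inj₂ (inj₁ refl)) (inj₂ (inj₂ refl)) = contradiction refl h
      rotation-last _ h (inj₂ (inj₂ refl)) (inj₁ refl)        = contradiction refl h
      rotation-last h _ (inj₂ (inj₂ refl)) (inj₂ (inj₁ refl)) = contradiction refl h

      IsLast : ℕ → Set
      IsLast q = 2 ≤ q × D 0 q

      IsLast? : ∀ q → Dec (IsLast q)
      IsLast? q = (2 ≤? q) ×-dec D? 0 q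

      AtVertex : Fin n × Fin n × Fin n → Set
      AtVertex t = IsCell 𝕋 t × HasVertex 𝕋 (vertex 0) t

      AtVertex? : ∀ t → Dec (AtVertex t)
      AtVertex? t = IsCell? 𝕋 t ×-dec HasVertex? 𝕋 (vertex 0) t

      triples : List (Fin n × Fin n × Fin n)
      triples = cartesianProduct (allFin n) (cartesianProduct (allFin n) (allFin n))

      ∈-triples : ∀ t → t ∈ triples
      ∈-triples (x , y , z) = ∈-cartesianProduct⁺ (∈-allFin x) (∈-cartesianProduct⁺ (∈-allFin y) (∈-allFin z))

      triples-unique : Unique triples
      triples-unique = Unique.cartesianProduct⁺ (Unique.allFin⁺ n)
        (Unique.cartesianProduct⁺ (Unique.allFin⁺ n) (Unique.allFin⁺ n))

      vertex-≢ : ∀ {p} → 0 < p → p < n → vertex 0 ≢ vertex p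
      vertex-≢ 0<p p<n eq = contradiction (vertex-injective z<s p<n eq) (<⇒≢ 0<p)

      cell-of-last : ∀ {q} → q < n → IsLast q → ∃[ t ] AtVertex t × CellWithLast q t
      cell-of-last {q} q<n (2≤q , closing) with apex tree ≤-refl z≤n (s≤s⁻¹ q<n) 2≤q closing
      ... | m , 0<m , m<q , first , last with cyclic-order 0<m m<q q<n
      ...   | inj₁ (0<m′ , m<q′) = (vertex 0 , vertex m , vertex q) ,
        (((0<m′ , m<q′) , first , last , closing) , inj₁ refl) ,
        cellWithLast m 0<m m<q q<n first last closing (0<m′ , m<q′) (inj₁ refl)
      ...   | inj₂ (inj₁ (q<0′ , 0<m′)) = (vertex q , vertex 0 , vertex m) ,
        (((q<0′ , 0<m′) , Edge-sym closing , first , Edge-sym last) , inj₂ (inj₁ refl)) ,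
        cellWithLast m 0<m m<q q<n first last closing (q<0′ , 0<m′) (inj₂ (inj₁ refl))
      ...   | inj₂ (inj₂ (m<q′ , q<0′)) = (vertex m , vertex q , vertex 0) ,
        (((m<q′ , q<0′) , last , Edge-sym closing , Edge-sym first) , inj₂ (inj₂ refl)) ,
        cellWithLast m 0<m m<q q<n first last closing (m<q′ , q<0′) (inj₂ (inj₂ refl))

      -- Indices in the other order would have the opposite orientation by `cyclic-order`.
      cyclic-positions : ∀ {p q} → p < n → q < n → Cyclic (position 0) (position p) (position q) → 0 < p × p < q
      cyclic-positions {p} {q} p<n q<n cyc with cyclic-≢ cyc
      ... | 0≢p , p≢q , 0≢q with <-cmp p q
      ...   | tri< p<q _ _  = n≢0⇒n>0 (λ { refl → 0≢p refl }) , p<q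
      ...   | tri≈ _ refl _ = contradiction refl p≢q
      ...   | tri> _ _ q<p  = contradiction cyc (cyclic-asym (cyclic-order (n≢0⇒n>0 λ { refl → 0≢q refl }) q<p p<n))

      last-of-cell : ∀ {t} → AtVertex t → ∃[ q ] q < n × IsLast q × CellWithLast q t
      last-of-cell {t@(x , y , z)} (((x<y , y<z) , xy , yz , xz) , at) = go at
        where
        conclude : ∀ {y z} → Cyclic (position 0) (toℕ y) (toℕ z) → Edge 𝕋 (vertex 0) y → Edge 𝕋 y z →
          Edge 𝕋 (vertex 0) z → Rotation (vertex 0) y z t → ∃[ q ] q < n × IsLast q × CellWithLast q t
        conclude {y} {z} cyc first last closing rot with vertex-surjective y | vertex-surjective z
        ... | p , p<n , refl | q , q<n , refl with cyclic-positions p<n q<n cyc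
        ...   | 0<p , p<q = q , q<n , (≤-trans (s≤s 0<p) p<q , closing) ,
          cellWithLast p 0<p p<q q<n first last closing (x<y , y<z) rot
        go : HasVertex 𝕋 (vertex 0) t → ∃[ q ] q < n × IsLast q × CellWithLast q t
        go (inj₁ refl)        = conclude (inj₁ (x<y , y<z)) xy yz xz (inj₁ refl)
        go (inj₂ (inj₁ refl)) = conclude (inj₂ (inj₁ (x<y , y<z))) yz (Edge-sym xz) (Edge-sym xy) (inj₂ (inj₁ refl))
        go (inj₂ (inj₂ refl)) = conclude (inj₂ (inj₂ (x<y , y<z))) (Edge-sym xz) xy (Edge-sym yz) (inj₂ (inj₂ refl))

      last-unique : ∀ {q q′ t} → CellWithLast q t → CellWithLast q′ t → q ≡ q′
      last-unique (cellWithLast m 0<m m<q q<n _ _ _ _ rot) (cellWithLast m′ 0<m′ m<q′ q<n′ _ _ _ _ rot′) =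
        vertex-injective q<n q<n′ (rotation-last
          (vertex-≢ 0<m′ (<-trans m<q′ q<n′)) (vertex-≢ (<-trans 0<m′ m<q′) q<n′) rot rot′)

      cell-unique : ∀ {q t t′} → CellWithLast q t → CellWithLast q t′ → t ≡ t′
      cell-unique (cellWithLast m 0<m m<q q<n f l _ s rot) (cellWithLast m′ 0<m′ m<q′ _ f′ l′ _ s′ rot′)
        with apex-unique (s≤s⁻¹ q<n) 0<m m<q 0<m′ m<q′ f l f′ l′
      ... | refl = rotation-unique rot s rot′ s′

      degree : ℕ → ℕ
      degree m = ∑[ x < n ] 𝟙 (D? x m)

      quiddity-lasts : quiddity 𝕋 (i ℤ.+ + 0) ≡ count IsLast? (upTo n)
      quiddity-lasts = ≤-antisym
        (count-≤ {R = λ t q → CellWithLast q t} AtVertex? IsLast? triples-unique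
          (λ _ at → let q , q<n , last , cell = last-of-cell at in q , ∈-upTo⁺ q<n , last , cell) cell-unique)
        (count-≤ {R = CellWithLast} IsLast? AtVertex? (Unique.upTo⁺ n)
          (λ q∈ last → let t , at , cell = cell-of-last (∈-upTo⁻ q∈) last in t , ∈-triples t , at , cell) last-unique)

      -- Going round `vertex 0`, every edge except the first, to `vertex 1`, closes exactly one
      -- cell.
      quiddity-degree : 1 + quiddity 𝕋 (i ℤ.+ + 0) ≡ degree 0
      quiddity-degree = begin
        1 + quiddity 𝕋 (i ℤ.+ + 0)
          ≡⟨ cong suc (trans quiddity-lasts (count-applyUpTo IsLast? (λ q → q) n)) ⟩
        1 + (∑[ q < n ] 𝟙 (IsLast? q))
          ≡⟨ cong (_+ (∑[ q < n ] 𝟙 (IsLast? q))) (∑-δ₁ {n} {1} (s≤s z<s)) ⟨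
        (∑[ q < n ] 𝟙 (q ≟ 1)) + (∑[ q < n ] 𝟙 (IsLast? q))
          ≡⟨ ∑-+ n (λ q → 𝟙 (q ≟ 1)) (λ q → 𝟙 (IsLast? q)) ⟨
        (∑[ q < n ] (𝟙 (q ≟ 1) + 𝟙 (IsLast? q)))
          ≡⟨ (∑-cong n λ q _ → 𝟙-disjoint (D? q 0) (q ≟ 1) (IsLast? q)
               (split q) (λ { refl → inj₁ (inj₂ (vertex-next 0)) }) (λ (_ , 0q) → Edge-sym 0q)
               (λ { refl (s≤s () , _) })) ⟨
        degree 0 ∎
        where
        open ≡-Reasoning
        split : ∀ q → D q 0 → q ≡ 1 ⊎ (2 ≤ q × D 0 q)
        split 0             q0 = contradiction q0 Edge-irrefl
        split 1             _  = inj₁ refl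
        split (suc (suc q)) q0 = inj₂ (s≤s (s≤s z≤n) , Edge-sym q0)

  -- The frieze of a triangulation

  ÷-exact : ∀ {x y} q .{{_ : ℤ.NonZero y}} → x ≡ q ℤ.* y → x ÷ y ≡ q
  ÷-exact {x} {y} q eq with y ∣? x
  ... | yes (divides q′ eq′) = ℤ.*-cancelʳ-≡ q′ q y (trans (sym eq′) eq)
  ... | no ¬y∣x              = contradiction (divides q eq) ¬y∣x

  ∑-rotate₁ : ∀ n (g : ℕ → ℕ) → g n ≡ g 0 → ∑[ x < n ] g (suc x) ≡ ∑ n g
  ∑-rotate₁ n g periodic = +-cancelˡ-≡ (g 0) _ _ (begin
    g 0 + (∑[ x < n ] g (suc x)) ≡⟨ ∑-suc n g ⟨
    ∑ n g + g n                  ≡⟨ +-comm (∑ n g) (g n) ⟩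
    g n + ∑ n g                  ≡⟨ cong (_+ ∑ n g) periodic ⟩
    g 0 + ∑ n g                  ∎)
    where open ≡-Reasoning

  +-cancelˡ-≤-ℤ : ∀ i {a b} → i ℤ.+ + a ℤ.≤ i ℤ.+ + b → a ≤ b
  +-cancelˡ-≤-ℤ i le = ≮⇒≥ λ b<a → ℤ.<⇒≱ (ℤ.+-monoʳ-< i (ℤ.+<+ b<a)) le

  ∑-rotate : ∀ n (g : ℤ → ℕ) → (∀ u → g (u ℤ.+ + n) ≡ g u) → ∀ i m →
    ∑[ x < n ] g (i ℤ.+ + m ℤ.+ + x) ≡ ∑[ x < n ] g (i ℤ.+ + x)
  ∑-rotate n g periodic i zero    = ∑-cong n λ x _ → cong (λ u → g (u ℤ.+ + x)) (ℤ.+-identityʳ i)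
  ∑-rotate n g periodic i (suc m) = trans (∑-cong n λ x _ → cong g (shift x))
    (trans (∑-rotate₁ n (λ x → g (i ℤ.+ + m ℤ.+ + x)) (trans (periodic (i ℤ.+ + m)) (cong g (sym (ℤ.+-identityʳ (i ℤ.+ + m))))))
      (∑-rotate n g periodic i m))
    where
    shift : ∀ x → i ℤ.+ + suc m ℤ.+ + x ≡ i ℤ.+ + m ℤ.+ + suc x
    shift x = trans (cong (ℤ._+ + x) (sym (+-suc-ℤ i m))) (+-suc-ℤʳ (i ℤ.+ + m) x)

  <∸1⇒2+≤ : ∀ {s t} → s < t ∸ 1 → 2 + s ≤ t
  <∸1⇒2+≤ {t = suc t} s<t = s≤s s<t

  -- Column `t` holds the rows with `s < t ∸ 1`; truncated subtraction leaves columns 0 and 1 empty.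
  ∑-triangle : ∀ M {P : ℕ → ℕ → Set} (P? : ∀ s t → Dec (P s t)) →
    ∑[ s < M ] ∑[ t < M ] 𝟙 ((2 + s ≤? t) ×-dec P? s t) ≡ ∑[ t < M ] ∑[ s < t ∸ 1 ] 𝟙 (P? s t)
  ∑-triangle M {P} P? = trans (∑-swap M M λ s t → 𝟙 ((2 + s ≤? t) ×-dec P? s t)) (∑-cong M column)
    where
    column : ∀ t → t < M → ∑[ s < M ] 𝟙 ((2 + s ≤? t) ×-dec P? s t) ≡ ∑[ s < t ∸ 1 ] 𝟙 (P? s t)
    column t t<M = trans
      (∑-extend (λ s → 𝟙 ((2 + s ≤? t) ×-dec P? s t)) (≤-trans (m∸n≤m t 1) (<⇒≤ t<M))
        λ s t≤s _ → 𝟙-false ((2 + s ≤? t) ×-dec P? s t) λ (2+s≤t , _) → <⇒≱ (∸-monoˡ-≤ 1 2+s≤t) t≤s)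
      (∑-cong (t ∸ 1) λ s s<t → 𝟙-cong ((2 + s ≤? t) ×-dec P? s t) (P? s t) proj₂ (<∸1⇒2+≤ s<t ,_))

  range-length-minus-2 : ∀ i t → i ℤ.+ t ℤ.- + 2 ℤ.+ 1ℤ ℤ.- i ≡ t ℤ.- 1ℤ
  range-length-minus-2 = ℤ.solve-∀

  -- For `t ≤ 1` the upper end lies below `i`, and the empty range agrees with `t ∸ 1 = 0`.
  range-minus-2 : ∀ i t → range i (i ℤ.+ + t ℤ.- + 2) ≡ applyUpTo (λ s → i ℤ.+ + s) (t ∸ 1)
  range-minus-2 i 0 rewrite range-length-minus-2 i (+ 0) = refl
  range-minus-2 i 1 rewrite range-length-minus-2 i (+ 1) = refl
  range-minus-2 i (suc (suc t)) = trans (cong (range i) (identity i (+ t))) (range-applyUpTo i t)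
    where
    identity : ∀ i t → i ℤ.+ (+ 2 ℤ.+ t) ℤ.- + 2 ≡ i ℤ.+ t
    identity = ℤ.solve-∀

  module Frieze {k : ℕ} (𝕋 : Triangulation (3 + k)) where

    open Triangulated 𝕋

    private
      n N : ℕ
      n = 3 + k
      N = 2 + k

    quiddity-periodic : ∀ u → quiddity 𝕋 (u ℤ.+ + n) ≡ quiddity 𝕋 u
    quiddity-periodic u = cong (λ w → count (λ t → IsCell? 𝕋 t ×-dec HasVertex? 𝕋 w t)
      (cartesianProduct (allFin n) (cartesianProduct (allFin n) (allFin n)))) (v-periodic u)

    -- Despite its name, `diagonalColumn` counts edges, so that the base edge is included when
    -- `t = N`.
    diagonalColumn unitColumn : ℤ → ℕ → ℕ
    diagonalColumn i t = ∑[ s < t ∸ 1 ] 𝟙 (Edge? 𝕋 (v (i ℤ.+ + s)) (v (i ℤ.+ + t)))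
    unitColumn i t = ∑[ s < t ∸ 1 ] 𝟙 (entry 𝕋 (t ∸ s) (i ℤ.+ + s) ℤ.≟ 1ℤ)

    -- Frieze entries inside a window.

    module _ (i : ℤ) where

      open TriangulatedWindow i

      -- A degree is a sum over a full period, so the window may be restarted at the vertex in
      -- question, where `quiddity-degree` applies.
      degree-quiddity : ∀ m → degree m ≡ 1 + quiddity 𝕋 (i ℤ.+ + m)
      degree-quiddity m = begin
        degree m
          ≡⟨ ∑-rotate n (λ u → 𝟙 (Edge? 𝕋 (v u) (vertex m)))
               (λ u → cong (λ x → 𝟙 (Edge? 𝕋 x (vertex m))) (v-periodic u)) i m ⟨
        (∑[ x < n ] 𝟙 (Edge? 𝕋 (v (i ℤ.+ + m ℤ.+ + x)) (vertex m)))
          ≡⟨ (∑-cong n λ x _ → cong (λ u → 𝟙 (Edge? 𝕋 (v (i ℤ.+ + m ℤ.+ + x)) (v u))) (ℤ.+-identityʳ (i ℤ.+ + m))) ⟨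
        TriangulatedWindow.degree (i ℤ.+ + m) 0
          ≡⟨ TriangulatedWindow.quiddity-degree (i ℤ.+ + m) ⟨
        1 + quiddity 𝕋 (i ℤ.+ + m ℤ.+ + 0)
          ≡⟨ cong (λ u → 1 + quiddity 𝕋 u) (ℤ.+-identityʳ (i ℤ.+ + m)) ⟩
        1 + quiddity 𝕋 (i ℤ.+ + m) ∎
        where open ≡-Reasoning

      private
        labelX = additive-extension tree 1ℤ 0ℤ
        labelY = additive-extension tree 0ℤ 1ℤ
        X Y : ℕ → ℤ
        X = proj₁ labelX
        Y = proj₁ labelY
        X-additive : Additive X tree
        X-additive = proj₂ (proj₂ (proj₂ labelX))
        Y-additive : Additive Y tree
        Y-additive = proj₂ (proj₂ (proj₂ labelY))

      open Determinant X Y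

      det-base : det 0 N ≡ 1ℤ
      det-base = cong₂ ℤ._-_
        (cong₂ ℤ._*_ (proj₁ (proj₂ labelX)) (proj₁ (proj₂ (proj₂ labelY))))
        (cong₂ ℤ._*_ (proj₁ (proj₂ (proj₂ labelX))) (proj₁ (proj₂ labelY)))

      det-edge′ : ∀ {p q} → p < q → q ≤ N → D p q → det p q ≡ 1ℤ
      det-edge′ p<q q≤N = det-edge tree ≤-refl X-additive Y-additive det-base z≤n p<q q≤N

      det-pos′ : ∀ {p q} → p < q → q ≤ N → ∃[ m ] det p q ≡ + suc m × (m ≡ 0 → D p q)
      det-pos′ = det-pos tree base-edge X-additive Y-additive det-base z≤n

      det-side : ∀ {p} → suc p ≤ N → det p (suc p) ≡ 1ℤ
      det-side {p} p<N = det-edge′ ≤-refl p<N (inj₁ (inj₁ (vertex-next p)))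

      det-nonZero : ∀ {p q} → p < q → q ≤ N → ℤ.NonZero (det p q)
      det-nonZero p<q q≤N with det-pos′ p<q q≤N
      ... | m , eq , _ = subst ℤ.NonZero (sym eq) _

      -- Both sides are one less than the degree of the vertex in the middle.
      det-quiddity : ∀ {p} → 2 + p ≤ N → det p (2 + p) ≡ + quiddity 𝕋 (i ℤ.+ + suc p)
      det-quiddity {p} p≤N = AbelianGroup.∙-cancelʳ ℤ.+-0-abelianGroup 1ℤ _ _ (begin
        det p (2 + p) ℤ.+ 1ℤ
          ≡⟨ det-neighbours tree ≤-refl X-additive Y-additive det-base z<s p≤N ⟩
        + neighbours 0 N (suc p)
          ≡⟨ cong +_ (∑-cong n λ x x<n → 𝟙-cong ((0 ≤? x) ×-dec (x ≤? N) ×-dec D? x (suc p)) (D? x (suc p))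
               (λ (_ , _ , xp) → xp) (λ xp → z≤n , s≤s⁻¹ x<n , xp)) ⟩
        + degree (suc p)
          ≡⟨ cong +_ (trans (degree-quiddity (suc p)) (+-comm 1 (quiddity 𝕋 (i ℤ.+ + suc p)))) ⟩
        + quiddity 𝕋 (i ℤ.+ + suc p) ℤ.+ 1ℤ ∎)
        where
        open ≡-Reasoning

      entry-det : ∀ d p → d + p ≤ N → entry 𝕋 d (i ℤ.+ + p) ≡ det p (d + p)
      entry-det 0 p _ = sym (det-refl p)
      entry-det 1 p p<N = sym (det-side p<N)
      entry-det 2 p p≤N = trans (cong (λ u → + quiddity 𝕋 u) (+-suc-ℤ i p)) (sym (det-quiddity p≤N))
      entry-det (suc (suc (suc d))) p p≤N = begin
        (entry 𝕋 (2 + d) (i ℤ.+ + p) ℤ.* entry 𝕋 (2 + d) (i ℤ.+ + p ℤ.+ 1ℤ) ℤ.- 1ℤ) ÷ entry 𝕋 (1 + d) (i ℤ.+ + p ℤ.+ 1ℤ)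
          ≡⟨ cong (λ u → (entry 𝕋 (2 + d) (i ℤ.+ + p) ℤ.* entry 𝕋 (2 + d) u ℤ.- 1ℤ) ÷ entry 𝕋 (1 + d) u) (+-suc-ℤ i p) ⟩
        (entry 𝕋 (2 + d) (i ℤ.+ + p) ℤ.* entry 𝕋 (2 + d) (i ℤ.+ + suc p) ℤ.- 1ℤ) ÷ entry 𝕋 (1 + d) (i ℤ.+ + suc p)
          ≡⟨ cong₂ (λ x y → (x ℤ.- 1ℤ) ÷ y)
               (cong₂ ℤ._*_ (entry-det (suc (suc d)) p (<⇒≤ p≤N))
                 (trans (entry-det (suc (suc d)) (suc p) (subst (_≤ N) (sym (+-suc (2 + d) p)) p≤N))
                   (cong (det (suc p)) (+-suc (2 + d) p))))
               (trans (entry-det (suc d) (suc p) (subst (_≤ N) (sym (+-suc (1 + d) p)) (<⇒≤ p≤N)))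
                 (cong (det (suc p)) (+-suc (1 + d) p))) ⟩
        (det p (2 + d + p) ℤ.* det (suc p) (3 + d + p) ℤ.- 1ℤ) ÷ det (suc p) (2 + d + p)
          -- The `1` of the frieze rule is the product of the determinants of two sides, at `p` and
          -- at `2 + d + p`; this turns the numerator into the left side of `plücker`, and
          -- positivity of the divisor makes the quotient unique.
          ≡⟨ ÷-exact (det p (3 + d + p)) {{det-nonZero (s≤s (s≤s (m≤n+m p d))) (<⇒≤ p≤N)}}
               (trans (cong (λ u → det p (2 + d + p) ℤ.* det (suc p) (3 + d + p) ℤ.- u)
                        (sym (cong₂ ℤ._*_ (det-side (≤-trans (s≤s (m≤n+m p (2 + d))) p≤N)) (det-side p≤N))))
                 (plücker p (suc p) (2 + d + p) (3 + d + p))) ⟩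
        det p (3 + d + p) ∎
        where open ≡-Reasoning

      entry-one⇒edge : ∀ {s t} → s < t → t ≤ N → entry 𝕋 (t ∸ s) (i ℤ.+ + s) ≡ 1ℤ → D s t
      entry-one⇒edge {s} {t} s<t t≤N one with det-pos′ s<t t≤N
      ... | m , eq , edge = edge (suc-injective (ℤ.+-injective (trans (sym eq) (trans (sym entry-st) one))))
        where
        entry-st : entry 𝕋 (t ∸ s) (i ℤ.+ + s) ≡ det s t
        entry-st = trans (entry-det (t ∸ s) s (subst (_≤ N) (sym (m∸n+n≡m (<⇒≤ s<t))) t≤N))
          (cong (det s) (m∸n+n≡m (<⇒≤ s<t)))

      edge⇒entry-one : ∀ {s t} → s < t → t ≤ N → D s t → entry 𝕋 (t ∸ s) (i ℤ.+ + s) ≡ 1ℤ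
      edge⇒entry-one {s} {t} s<t t≤N st = trans
        (entry-det (t ∸ s) s (subst (_≤ N) (sym (m∸n+n≡m (<⇒≤ s<t))) t≤N))
        (trans (cong (det s) (m∸n+n≡m (<⇒≤ s<t))) (det-edge′ s<t t≤N st))

      unitColumn-window : ∀ {t} → t ≤ N → unitColumn i t ≡ diagonalColumn i t
      unitColumn-window {t} t≤N = ∑-cong (t ∸ 1) λ s s<t∸1 →
        let s<t = <-≤-trans s<t∸1 (m∸n≤m t 1) in
        𝟙-cong (entry 𝕋 (t ∸ s) (i ℤ.+ + s) ℤ.≟ 1ℤ) (D? s t) (entry-one⇒edge s<t t≤N) (edge⇒entry-one s<t t≤N)

      -- Of the neighbours of `vertex N`, the column misses only the adjacent one, `suc k`, since
      -- its rows stop two short of `N`.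
      diagonalColumn-last : diagonalColumn i N ≡ quiddity 𝕋 (i ℤ.+ + N)
      diagonalColumn-last = suc-injective (trans (sym split) (degree-quiddity N))
        where
        split : degree N ≡ 1 + diagonalColumn i N
        split rewrite 𝟙-false (D? N N) Edge-irrefl | 𝟙-true (D? (suc k) N) (inj₁ (inj₁ (vertex-next (suc k)))) =
          trans (+-identityʳ _) (+-comm _ 1)

      entry-N : entry 𝕋 N i ≡ 1ℤ
      entry-N = trans (cong (entry 𝕋 N) (sym (ℤ.+-identityʳ i))) (edge⇒entry-one {0} {N} z<s ≤-refl base-edge)

      entry-nonZero : ∀ d → 0 < d → d ≤ N → ℤ.NonZero (entry 𝕋 d i)
      entry-nonZero d 0<d d≤N = subst ℤ.NonZero
        (trans (cong (det 0) (sym (+-identityʳ d)))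
          (trans (sym (entry-det d 0 (subst (_≤ N) (sym (+-identityʳ d)) d≤N))) (cong (entry 𝕋 d) (ℤ.+-identityʳ i))))
        (det-nonZero 0<d d≤N)

      diagonalColumns-total : ∑[ t < n ] diagonalColumn i t ≡ suc k
      diagonalColumns-total = trans (sym (trans
        (∑-cong n λ s _ → ∑-cong n λ t t<n → 𝟙-cong (Inside? 0 N s t) ((2 + s ≤? t) ×-dec D? s t)
          (λ (_ , s<t , _ , st) → s<t , st) (λ (s<t , st) → z≤n , s<t , s≤s⁻¹ t<n , st))
        (∑-triangle n D?))) chords-total

      -- Descendant degrees as column sums.

      descendants : ∀ t → t ≤ N → μ 𝕋 i (i ℤ.+ + t) ≡ ∑[ s < t ∸ 1 ] 𝟙 (Diagonal? 𝕋 (vertex s) (vertex t))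
      descendants t t≤N rewrite dec-true (i ℤ.+ + t ℤ.≤? i ℤ.+ + n ℤ.- 1ℤ)
        (ℤ.≤-trans (ℤ.+-monoʳ-≤ i (ℤ.+≤+ t≤N)) (ℤ.≤-reflexive (sym (ℤ.+-assoc i (+ n) ℤ.-1ℤ)))) =
        trans (cong (count (λ α → Diagonal? 𝕋 (v α) (vertex t))) (range-minus-2 i t))
          (count-applyUpTo (λ α → Diagonal? 𝕋 (v α) (vertex t)) (λ s → i ℤ.+ + s) (t ∸ 1))

      descendants-beyond : ∀ t → N < t → μ 𝕋 i (i ℤ.+ + t) ≡ 0
      descendants-beyond t N<t rewrite dec-false (i ℤ.+ + t ℤ.≤? i ℤ.+ + n ℤ.- 1ℤ)
        (ℤ.<⇒≱ (ℤ.≤-<-trans (ℤ.≤-reflexive (ℤ.+-assoc i (+ n) ℤ.-1ℤ)) (ℤ.+-monoʳ-< i (ℤ.+<+ N<t)))) = refl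

      -- A side of the polygon with a gap of two is the base edge, and `inner` excludes it.
      edge-diagonal : ∀ {s t} → 2 + s ≤ t → t ≤ N → 0 < s ⊎ t < N →
        𝟙 (D? s t) ≡ 𝟙 (Diagonal? 𝕋 (vertex s) (vertex t))
      edge-diagonal {s} {t} 2+s≤t t≤N inner = 𝟙-cong (D? s t) (Diagonal? 𝕋 (vertex s) (vertex t)) (to inner) inj₂
        where
        to : 0 < s ⊎ t < N → D s t → Diagonal 𝕋 (vertex s) (vertex t)
        to _     (inj₂ diagonal) = diagonal
        to inner (inj₁ side) with side-positions (<⇒≤ 2+s≤t) (s≤s t≤N) side | inner
        ... | inj₁ refl          | _        = contradiction 2+s≤t (n≮n t)
        ... | inj₂ (refl , refl) | inj₁ 0<0 = contradiction 0<0 (n≮n 0)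
        ... | inj₂ (refl , refl) | inj₂ N<N = contradiction N<N (n≮n N)

      diagonalColumn-descendants : ∀ {t} → t < N → diagonalColumn i t ≡ μ 𝕋 i (i ℤ.+ + t)
      diagonalColumn-descendants {t} t<N = trans
        (∑-cong (t ∸ 1) λ s s<t → edge-diagonal (<∸1⇒2+≤ s<t) (<⇒≤ t<N) (inj₂ t<N)) (sym (descendants t (<⇒≤ t<N)))

      -- The base edge, in row 0, is an edge but no diagonal; this is the extra one of the theorem.
      diagonalColumn-base : diagonalColumn i N ≡ μ 𝕋 i (i ℤ.+ + N) + 1
      diagonalColumn-base = begin
        ∑[ s < suc k ] 𝟙 (D? s N)
          ≡⟨ ∑-suc k (λ s → 𝟙 (D? s N)) ⟩
        𝟙 (D? 0 N) + (∑[ s < k ] 𝟙 (D? (suc s) N))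
          ≡⟨ cong₂ _+_ (𝟙-true (D? 0 N) base-edge) (∑-cong k λ s s<k → edge-diagonal (s≤s (s≤s s<k)) ≤-refl (inj₁ z<s)) ⟩
        1 + (∑[ s < k ] diagonal (suc s))
          ≡⟨ cong (λ m → 1 + (m + (∑[ s < k ] diagonal (suc s))))
               (𝟙-false (Diagonal? 𝕋 (vertex 0) (vertex N)) λ d → Diagonal⇒¬Side d base-side) ⟨
        1 + (diagonal 0 + (∑[ s < k ] diagonal (suc s)))
          ≡⟨ cong suc (∑-suc k diagonal) ⟨
        1 + (∑[ s < suc k ] diagonal s)
          ≡⟨ trans (+-comm 1 _) (cong (_+ 1) (sym (descendants N ≤-refl))) ⟩
        μ 𝕋 i (i ℤ.+ + N) + 1 ∎
        where
        open ≡-Reasoning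
        diagonal : ℕ → ℕ
        diagonal s = 𝟙 (Diagonal? 𝕋 (vertex s) (vertex N))
        base-side : Side (vertex 0) (vertex N)
        base-side = inj₂ (subst (Next (vertex N)) vertex-n (vertex-next N))

      ν-columns : ∀ m → νᵗʳⁱ 𝕋 i (i ℤ.+ + m) ≡ ∑[ t < suc m ] unitColumn i t
      ν-columns m rewrite range-applyUpTo i m = trans
        (count-cartesianProduct (λ { (a , b) → (a ℤ.+ + 2 ℤ.≤? b) ×-dec (σ 𝕋 a b ℤ.≟ 1ℤ) })
          (λ s → i ℤ.+ + s) (λ s → i ℤ.+ + s) (suc m) (suc m))
        (trans (∑-cong (suc m) λ s _ → ∑-cong (suc m) λ t _ → 𝟙-cong
            ((i ℤ.+ + s ℤ.+ + 2 ℤ.≤? i ℤ.+ + t) ×-dec (σ 𝕋 (i ℤ.+ + s) (i ℤ.+ + t) ℤ.≟ 1ℤ))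
            ((2 + s ≤? t) ×-dec (entry 𝕋 (t ∸ s) (i ℤ.+ + s) ℤ.≟ 1ℤ))
            (λ (far , one) → gap far , trans (cong (λ d → entry 𝕋 d (i ℤ.+ + s)) (sym (width (gap far)))) one)
            (λ (far , one) → gap⁻ far , trans (cong (λ d → entry 𝕋 d (i ℤ.+ + s)) (width far)) one))
          (∑-triangle (suc m) λ s t → entry 𝕋 (t ∸ s) (i ℤ.+ + s) ℤ.≟ 1ℤ))
        where
        shift : ∀ s → i ℤ.+ + s ℤ.+ + 2 ≡ i ℤ.+ + (2 + s)
        shift s = trans (ℤ.+-assoc i (+ s) (+ 2)) (cong (λ t → i ℤ.+ + t) (+-comm s 2))
        gap : ∀ {s t} → i ℤ.+ + s ℤ.+ + 2 ℤ.≤ i ℤ.+ + t → 2 + s ≤ t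
        gap {s} {t} le = +-cancelˡ-≤-ℤ i (subst (ℤ._≤ i ℤ.+ + t) (shift s) le)
        gap⁻ : ∀ {s t} → 2 + s ≤ t → i ℤ.+ + s ℤ.+ + 2 ℤ.≤ i ℤ.+ + t
        gap⁻ {s} {t} le = subst (ℤ._≤ i ℤ.+ + t) (sym (shift s)) (ℤ.+-monoʳ-≤ i (ℤ.+≤+ le))
        width : ∀ {s t} → 2 + s ≤ t → ℤ.∣ i ℤ.+ + t ℤ.- (i ℤ.+ + s) ∣ ≡ t ∸ s
        width {s} {t} le = trans (cong ℤ.∣_∣ (trans (identity i (+ t) (+ s)) (ℤ.m-n≡m⊖n t s)))
          (trans (cong ℤ.∣_∣ (ℤ.⊖-≥ (≤-trans (m≤n+m s 2) le))) refl)
          where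
          identity : ∀ i t s → i ℤ.+ t ℤ.- (i ℤ.+ s) ≡ t ℤ.- s
          identity = ℤ.solve-∀

      ℓ-columns : ∀ m → ℓ 𝕋 i (i ℤ.+ + m) ≡ ∑[ t < suc m ] μ 𝕋 i (i ℤ.+ + t)
      ℓ-columns m = trans (cong (λ u → accumulate 𝕋 i ℤ.∣ u ∣) (range-length i m)) (go (suc m))
        where
        go : ∀ d → accumulate 𝕋 i d ≡ ∑[ t < d ] μ 𝕋 i (i ℤ.+ + t)
        go zero    = refl
        go (suc d) = cong (_+ μ 𝕋 i (i ℤ.+ + d)) (go d)

    -- The two columns beyond the window.

    entry-n : ∀ u → entry 𝕋 n u ≡ 0ℤ
    entry-n u = begin
      entry 𝕋 n u
        ≡⟨⟩
      (entry 𝕋 N u ℤ.* entry 𝕋 N (u ℤ.+ 1ℤ) ℤ.- 1ℤ) ÷ entry 𝕋 (suc k) (u ℤ.+ 1ℤ)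
        -- An entry of width `N` belongs to the base edge of the window starting there, hence is 1
        -- for every start.
        ≡⟨ cong₂ (λ x y → (x ℤ.* y ℤ.- 1ℤ) ÷ entry 𝕋 (suc k) (u ℤ.+ 1ℤ)) (entry-N u) (entry-N (u ℤ.+ 1ℤ)) ⟩
      0ℤ ÷ entry 𝕋 (suc k) (u ℤ.+ 1ℤ)
        ≡⟨ ÷-exact {0ℤ} {entry 𝕋 (suc k) (u ℤ.+ 1ℤ)} 0ℤ {{entry-nonZero (u ℤ.+ 1ℤ) (suc k) z<s (n≤1+n (suc k))}} refl ⟩
      0ℤ ∎
      where open ≡-Reasoning

    entry-1+n : ∀ u → entry 𝕋 (1 + n) u ≡ ℤ.-1ℤ
    entry-1+n u = begin
      entry 𝕋 (1 + n) u
        ≡⟨⟩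
      (entry 𝕋 n u ℤ.* entry 𝕋 n (u ℤ.+ 1ℤ) ℤ.- 1ℤ) ÷ entry 𝕋 N (u ℤ.+ 1ℤ)
        ≡⟨ cong₂ (λ x y → (x ℤ.- 1ℤ) ÷ y) (cong₂ ℤ._*_ (entry-n u) (entry-n (u ℤ.+ 1ℤ))) (entry-N (u ℤ.+ 1ℤ)) ⟩
      ℤ.-1ℤ ÷ 1ℤ
        ≡⟨⟩
      ℤ.-1ℤ ∎
      where open ≡-Reasoning

    -- Once the widest entry is known not to be a one, the rest is a column of the frieze read from
    -- `i + 1`.
    unitColumn-suc : ∀ i t → entry 𝕋 (2 + t) i ≢ 1ℤ → unitColumn i (2 + t) ≡ unitColumn (i ℤ.+ 1ℤ) (1 + t)
    unitColumn-suc i t ≢1 = trans (∑-suc t (λ s → 𝟙 (entry 𝕋 (2 + t ∸ s) (i ℤ.+ + s) ℤ.≟ 1ℤ)))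
      (cong₂ _+_
        (𝟙-false (entry 𝕋 (2 + t) (i ℤ.+ + 0) ℤ.≟ 1ℤ) (λ eq → ≢1 (trans (cong (entry 𝕋 (2 + t)) (sym (ℤ.+-identityʳ i))) eq)))
        (∑-cong t λ s _ → cong (λ u → 𝟙 (entry 𝕋 (1 + t ∸ s) u ℤ.≟ 1ℤ)) (sym (+-suc-ℤʳ i s))))

    -- Dropping the zero of width `n` leaves the last column of the window at `i + 1`, whose last
    -- vertex is that of `i` again.
    unitColumn-n : ∀ i → unitColumn i n ≡ quiddity 𝕋 i
    unitColumn-n i = begin
      unitColumn i n                        ≡⟨ unitColumn-suc i (suc k) (λ eq → contradiction (trans (sym (entry-n i)) eq) λ ()) ⟩
      unitColumn (i ℤ.+ 1ℤ) N               ≡⟨ unitColumn-window (i ℤ.+ 1ℤ) ≤-refl ⟩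
      diagonalColumn (i ℤ.+ 1ℤ) N           ≡⟨ diagonalColumn-last (i ℤ.+ 1ℤ) ⟩
      quiddity 𝕋 (i ℤ.+ 1ℤ ℤ.+ + N)         ≡⟨ cong (quiddity 𝕋) (+-suc-ℤʳ i N) ⟩
      quiddity 𝕋 (i ℤ.+ + n)                ≡⟨ quiddity-periodic i ⟩
      quiddity 𝕋 i                          ∎
      where open ≡-Reasoning

    -- The entry `-1` of width `n + 1` drops out first, then the zero of width `n`.
    unitColumn-1+n : ∀ i → unitColumn i (1 + n) ≡ quiddity 𝕋 (i ℤ.+ 1ℤ)
    unitColumn-1+n i = trans
      (unitColumn-suc i N (λ eq → contradiction (trans (sym (entry-1+n i)) eq) λ ()))
      (unitColumn-n (i ℤ.+ 1ℤ))

    -- Accumulated counts and the four cases.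

    module _ (i : ℤ) where

      ν-below : ∀ {m} → m < N → νᵗʳⁱ 𝕋 i (i ℤ.+ + m) ≡ ℓ 𝕋 i (i ℤ.+ + m)
      ν-below {m} m<N = begin
        νᵗʳⁱ 𝕋 i (i ℤ.+ + m)                    ≡⟨ ν-columns i m ⟩
        (∑[ t < suc m ] unitColumn i t)         ≡⟨ (∑-cong (suc m) λ t t≤m → let t<N = ≤-<-trans (s≤s⁻¹ t≤m) m<N in
                                                    trans (unitColumn-window i (<⇒≤ t<N)) (diagonalColumn-descendants i t<N)) ⟩
        (∑[ t < suc m ] μ 𝕋 i (i ℤ.+ + t))      ≡⟨ ℓ-columns i m ⟨
        ℓ 𝕋 i (i ℤ.+ + m)                       ∎
        where open ≡-Reasoning

      ν-suc : ∀ m → νᵗʳⁱ 𝕋 i (i ℤ.+ + suc m) ≡ νᵗʳⁱ 𝕋 i (i ℤ.+ + m) + unitColumn i (suc m)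
      ν-suc m = trans (ν-columns i (suc m)) (cong (_+ unitColumn i (suc m)) (sym (ν-columns i m)))

      ℓ-suc : ∀ m → ℓ 𝕋 i (i ℤ.+ + suc m) ≡ ℓ 𝕋 i (i ℤ.+ + m) + μ 𝕋 i (i ℤ.+ + suc m)
      ℓ-suc m = trans (ℓ-columns i (suc m)) (cong (_+ μ 𝕋 i (i ℤ.+ + suc m)) (sym (ℓ-columns i m)))

      ν-N : νᵗʳⁱ 𝕋 i (i ℤ.+ + N) ≡ ℓ 𝕋 i (i ℤ.+ + N) + 1
      ν-N = begin
        νᵗʳⁱ 𝕋 i (i ℤ.+ + N)
          ≡⟨ ν-suc (suc k) ⟩
        νᵗʳⁱ 𝕋 i (i ℤ.+ + suc k) + unitColumn i N
          ≡⟨ cong₂ _+_ (ν-below ≤-refl) (trans (unitColumn-window i ≤-refl) (diagonalColumn-base i)) ⟩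
        ℓ 𝕋 i (i ℤ.+ + suc k) + (μ 𝕋 i (i ℤ.+ + N) + 1)
          ≡⟨ +-assoc _ (μ 𝕋 i (i ℤ.+ + N)) 1 ⟨
        ℓ 𝕋 i (i ℤ.+ + suc k) + μ 𝕋 i (i ℤ.+ + N) + 1
          ≡⟨ cong (_+ 1) (ℓ-suc (suc k)) ⟨
        ℓ 𝕋 i (i ℤ.+ + N) + 1 ∎
        where open ≡-Reasoning

      -- By `ν-N` the left side counts the ones of the whole window, that is, its `n - 2` chords.
      ℓ-N : ℓ 𝕋 i (i ℤ.+ + N) + 1 ≡ suc k
      ℓ-N = trans (sym ν-N) (trans (ν-columns i N)
        (trans (∑-cong n λ t t<n → unitColumn-window i (s≤s⁻¹ t<n)) (diagonalColumns-total i)))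

      ℓ-n : ℓ 𝕋 i (i ℤ.+ + n) ≡ ℓ 𝕋 i (i ℤ.+ + N)
      ℓ-n = trans (ℓ-suc N) (trans (cong (λ m → ℓ 𝕋 i (i ℤ.+ + N) + m) (descendants-beyond i n ≤-refl)) (+-identityʳ _))

      ℓ-1+n : ℓ 𝕋 i (i ℤ.+ + (1 + n)) ≡ ℓ 𝕋 i (i ℤ.+ + n)
      ℓ-1+n = trans (ℓ-suc n) (trans (cong (λ m → ℓ 𝕋 i (i ℤ.+ + n) + m) (descendants-beyond i (1 + n) (n≤1+n n))) (+-identityʳ _))

      ν-n : νᵗʳⁱ 𝕋 i (i ℤ.+ + n) ≡ suc k + quiddity 𝕋 i
      ν-n = trans (ν-suc N) (cong₂ _+_ (trans ν-N ℓ-N) (unitColumn-n i))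

      ν-1+n : νᵗʳⁱ 𝕋 i (i ℤ.+ + (1 + n)) ≡ suc k + quiddity 𝕋 i + quiddity 𝕋 (i ℤ.+ 1ℤ)
      ν-1+n = trans (ν-suc n) (cong₂ _+_ ν-n (unitColumn-1+n i))

      ℓ-n-total : ℓ 𝕋 i (i ℤ.+ + n) + quiddity 𝕋 i + 1 ≡ suc k + quiddity 𝕋 i
      ℓ-n-total = trans (rearrange (ℓ 𝕋 i (i ℤ.+ + n)) (quiddity 𝕋 i))
        (cong (_+ quiddity 𝕋 i) (trans (cong (_+ 1) ℓ-n) ℓ-N))
        where
        rearrange : ∀ a b → a + b + 1 ≡ a + 1 + b
        rearrange = ℕ.solve-∀

      ℓ-1+n-total : ℓ 𝕋 i (i ℤ.+ + (1 + n)) + quiddity 𝕋 i + quiddity 𝕋 (i ℤ.+ 1ℤ) + 1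
        ≡ suc k + quiddity 𝕋 i + quiddity 𝕋 (i ℤ.+ 1ℤ)
      ℓ-1+n-total = trans (rearrange (ℓ 𝕋 i (i ℤ.+ + (1 + n))) (quiddity 𝕋 i) (quiddity 𝕋 (i ℤ.+ 1ℤ)))
        (cong (_+ quiddity 𝕋 (i ℤ.+ 1ℤ)) (trans (cong (λ m → m + quiddity 𝕋 i + 1) ℓ-1+n) ℓ-n-total))
        where
        rearrange : ∀ a b c → a + b + c + 1 ≡ a + b + 1 + c
        rearrange = ℕ.solve-∀

    module _ (i j : ℤ) where

      ν-case-below : 0ℤ ℤ.≤ j ℤ.- i → j ℤ.≤ i ℤ.+ + n ℤ.- + 2 → νᵗʳⁱ 𝕋 i j ≡ ℓ 𝕋 i j
      ν-case-below 0≤j-i j≤ = subst (λ u → νᵗʳⁱ 𝕋 i u ≡ ℓ 𝕋 i u) (sym j≡i+m)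
        (ν-below i (s≤s (+-cancelˡ-≤-ℤ i (subst₂ ℤ._≤_ j≡i+m (ℤ.+-assoc i (+ n) (ℤ.- + 2)) j≤))))
        where
        identity : ∀ i j → j ≡ i ℤ.+ (j ℤ.- i)
        identity = ℤ.solve-∀
        j≡i+m : j ≡ i ℤ.+ + ℤ.∣ j ℤ.- i ∣
        j≡i+m = trans (identity i j) (cong (λ u → i ℤ.+ u) (sym (ℤ.0≤i⇒+∣i∣≡i 0≤j-i)))

      ν-case-N : j ≡ i ℤ.+ + n ℤ.- 1ℤ →
        (νᵗʳⁱ 𝕋 i j ≡ ℓ 𝕋 i (i ℤ.+ + n ℤ.- 1ℤ) + 1) × (ℓ 𝕋 i (i ℤ.+ + n ℤ.- 1ℤ) + 1 ≡ suc k)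
      ν-case-N eq = trans (cong (νᵗʳⁱ 𝕋 i) (trans eq i+N)) (trans (ν-N i) (cong (λ u → ℓ 𝕋 i u + 1) (sym i+N))) ,
        trans (cong (λ u → ℓ 𝕋 i u + 1) i+N) (ℓ-N i)
        where
        i+N : i ℤ.+ + n ℤ.- 1ℤ ≡ i ℤ.+ + N
        i+N = ℤ.+-assoc i (+ n) ℤ.-1ℤ

      ν-case-n : j ≡ i ℤ.+ + n →
        (νᵗʳⁱ 𝕋 i j ≡ ℓ 𝕋 i (i ℤ.+ + n) + quiddity 𝕋 i + 1) ×
        (ℓ 𝕋 i (i ℤ.+ + n) + quiddity 𝕋 i + 1 ≡ suc k + quiddity 𝕋 i)
      ν-case-n eq = trans (cong (νᵗʳⁱ 𝕋 i) eq) (trans (ν-n i) (sym (ℓ-n-total i))) , ℓ-n-total i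

      ν-case-1+n : j ≡ i ℤ.+ + n ℤ.+ 1ℤ →
        (νᵗʳⁱ 𝕋 i j ≡ ℓ 𝕋 i (i ℤ.+ + n ℤ.+ 1ℤ) + quiddity 𝕋 i + quiddity 𝕋 (i ℤ.+ 1ℤ) + 1) ×
        (ℓ 𝕋 i (i ℤ.+ + n ℤ.+ 1ℤ) + quiddity 𝕋 i + quiddity 𝕋 (i ℤ.+ 1ℤ) + 1
          ≡ suc k + quiddity 𝕋 i + quiddity 𝕋 (i ℤ.+ 1ℤ))
      ν-case-1+n eq = trans (cong (νᵗʳⁱ 𝕋 i) (trans eq i+1+n)) (trans (trans (ν-1+n i) (sym (ℓ-1+n-total i))) (sym ℓ-shift)) ,
        trans ℓ-shift (ℓ-1+n-total i)
        where
        i+1+n : i ℤ.+ + n ℤ.+ 1ℤ ≡ i ℤ.+ + (1 + n)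
        i+1+n = +-suc-ℤ i n
        ℓ-shift : ℓ 𝕋 i (i ℤ.+ + n ℤ.+ 1ℤ) + quiddity 𝕋 i + quiddity 𝕋 (i ℤ.+ 1ℤ) + 1
          ≡ ℓ 𝕋 i (i ℤ.+ + (1 + n)) + quiddity 𝕋 i + quiddity 𝕋 (i ℤ.+ 1ℤ) + 1
        ℓ-shift = cong (λ u → ℓ 𝕋 i u + quiddity 𝕋 i + quiddity 𝕋 (i ℤ.+ 1ℤ) + 1) i+1+n

open import Data.Integer.Base using (_+_; _-_; _≤_)

proposition4p2 : (n : ℕ) .{{_ : NonZero n}} → 3 ℕ.≤ n →
    (𝕋 : Triangulation n) →
    let c = quiddity 𝕋 in
    (i j : ℤ) → 0ℤ ≤ j - i → j - i ≤ + (n ℕ.+ 1) →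
    (i ≤ j → j ≤ i + + n - + 2 →
    νᵗʳⁱ 𝕋 i j ≡ ℓ 𝕋 i j)
    × (j ≡ i + + n - 1ℤ →
    (νᵗʳⁱ 𝕋 i j ≡ ℓ 𝕋 i (i + + n - 1ℤ) ℕ.+ 1)
    × (ℓ 𝕋 i (i + + n - 1ℤ) ℕ.+ 1 ≡ n ℕ.∸ 2))
    × (j ≡ i + + n →
    (νᵗʳⁱ 𝕋 i j ≡ ℓ 𝕋 i (i + + n) ℕ.+ c i ℕ.+ 1)
    × (ℓ 𝕋 i (i + + n) ℕ.+ c i ℕ.+ 1 ≡ n ℕ.∸ 2 ℕ.+ c i))
    × (j ≡ i + + n + 1ℤ →
    (νᵗʳⁱ 𝕋 i j ≡ ℓ 𝕋 i (i + + n + 1ℤ) ℕ.+ c i ℕ.+ c (i + 1ℤ) ℕ.+ 1)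
    × (ℓ 𝕋 i (i + + n + 1ℤ) ℕ.+ c i ℕ.+ c (i + 1ℤ) ℕ.+ 1 ≡ n ℕ.∸ 2 ℕ.+ c i ℕ.+ c (i + 1ℤ)))
proposition4p2 (suc (suc (suc k))) (s≤s (s≤s (s≤s z≤n))) 𝕋 i j 0≤j-i _ =
  (λ _ → ν-case-below i j 0≤j-i) , ν-case-N i j , ν-case-n i j , ν-case-1+n i j
  where open FriezeTheory.Frieze 𝕋
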